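{- For every integer $j$, \[ \sum_{\mu\in \mathcal{P}_j}t^{h_{2,0}(\mu)}q^{|\mu|}= \frac{q^{\binom{2j}{2}}}{\prod_{i\geq 1}(1-q^{2i})(1-tq^{2i})}. \]
   Context: The $2$-core of a partition is obtained by repeatedly removing dominoes (rim hooks of length $2$) whose removal leaves a Young diagram until none remain; it is well defined, a staircase of size $\binom{2j}{2}=j(2j-1)$ for a unique integer $j$. $\mathcal{P}_j$ is the set of all partitions whose $2$-core has size $\binom{2j}{2}$. For a cell $v$, $a_v$ is its arm length (cells to its right) and $l_v$ its leg length (cells below it); $h_{2,0}(\mu)$ is the number of cells $v$ with $l_v=0$ and $2\mid a_v+1$. -}

module Defs where

open import Data.Nat using (ℕ; zero; suc; _+_; _*_; _∸_; _≤_; _<_; _≤ᵇ_; _<ᵇ_; _≡ᵇ_)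
open import Data.Nat.Divisibility using (_∣_)
open import Data.Bool using (Bool; true; false; if_then_else_; _∧_)
open import Data.Maybe using (Maybe; just; nothing)
open import Data.Nat.ListAction using (sum)
open import Data.List using (List; []; _∷_; length; map; concatMap; upTo; zip; drop)
open import Data.List.Relation.Unary.All using (All)
open import Data.List.Relation.Unary.Linked using (Linked)
open import Data.Product using (Σ; _×_; _,_)
open import Data.Integer as ℤ using (ℤ; +_; ∣_∣)
open import Relation.Binary.PropositionalEquality using (_≡_)

IsPartition : List ℕ → Set
IsPartition μ = Linked (λ a b → b ≤ a) μ × All (λ x → 0 < x) μ

size : List ℕ → ℕ
size = sum

headOr0 : List ℕ → ℕ
headOr0 []      = 0
headOr0 (x ∷ _) = x

dropZeros : List ℕ → List ℕ
dropZeros []       = []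
dropZeros (0 ∷ xs) = dropZeros xs
dropZeros (x ∷ xs) = x ∷ dropZeros xs

-- Remove one domino (rim hook of length 2) whose removal leaves a Young
-- diagram, if any exists: either a horizontal domino at the end of a row
-- (row i has λ_i ≥ λ_{i+1} + 2) or a vertical domino at the ends of rows
-- i, i+1 (λ_i = λ_{i+1} > λ_{i+2}).  The first one found is removed.
removeDomino : List ℕ → Maybe (List ℕ)
removeDomino [] = nothing
removeDomino (x ∷ xs) =
  if (headOr0 xs + 2) ≤ᵇ x
  then just (dropZeros ((x ∸ 2) ∷ xs))
  else vert xs
  where
  vert : List ℕ → Maybe (List ℕ)
  vert [] = nothing
  vert (y ∷ rest) =
    if (x ≡ᵇ y) ∧ (headOr0 rest <ᵇ y)
    then just (dropZeros ((x ∸ 1) ∷ (y ∸ 1) ∷ rest))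
    else Data.Maybe.map (x ∷_) (removeDomino (y ∷ rest))

coreWith : ℕ → List ℕ → List ℕ
coreWith zero    μ = μ
coreWith (suc f) μ with removeDomino μ
... | nothing = μ
... | just ν  = coreWith f ν

-- The 2-core: each removal lowers the size by 2, so |μ| steps suffice.
twoCore : List ℕ → List ℕ
twoCore μ = coreWith (size μ) μ

-- binom(2j,2) = j(2j-1), as an integer.
binom2j : ℤ → ℤ
binom2j j = j ℤ.* ((+ 2) ℤ.* j ℤ.- (+ 1))

InP : ℤ → List ℕ → Set
InP j μ = + (size (twoCore μ)) ≡ binom2j j

-- Arm, leg, h_{2,0}.  Cells are pairs (i , c), row i, column c (0-indexed),
-- with c < μ_i.

lookup0 : List ℕ → ℕ → ℕ
lookup0 []       _       = 0
lookup0 (x ∷ _)  zero    = x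
lookup0 (_ ∷ xs) (suc i) = lookup0 xs i

cells : List ℕ → List (ℕ × ℕ)
cells μ = concatMap (λ { (i , r) → map (λ c → (i , c)) (upTo r) }) (zip (upTo (length μ)) μ)

arm : List ℕ → ℕ × ℕ → ℕ
arm μ (i , c) = lookup0 μ i ∸ suc c

countB : {A : Set} → (A → Bool) → List A → ℕ
countB p []       = 0
countB p (x ∷ xs) = if p x then suc (countB p xs) else countB p xs

leg : List ℕ → ℕ × ℕ → ℕ
leg μ (i , c) = countB (λ r → c <ᵇ r) (drop (suc i) μ)

even? : ℕ → Bool
even? zero          = true
even? (suc zero)    = false
even? (suc (suc n)) = even? n

h20 : List ℕ → ℕ
h20 μ = countB (λ v → (leg μ v ≡ᵇ 0) ∧ even? (arm μ v + 1)) (cells μ)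

-- Formal power series in t, q with integer coefficients:
-- F k n = coefficient of t^k q^n.

Series : Set
Series = ℕ → ℕ → ℤ

Σ≤ : ℕ → (ℕ → ℤ) → ℤ
Σ≤ zero    f = f 0
Σ≤ (suc n) f = Σ≤ n f ℤ.+ f (suc n)

_·_ : Series → Series → Series
(F · G) k n = Σ≤ k (λ a → Σ≤ n (λ b → F a b ℤ.* G (k ∸ a) (n ∸ b)))

mono : ℕ → ℕ → Series
mono a b k n = if (a ≡ᵇ k) ∧ (b ≡ᵇ n) then + 1 else + 0

one : Series
one = mono 0 0

_-ₛ_ : Series → Series → Series
(F -ₛ G) k n = F k n ℤ.- G k n

factor : ℕ → Series
factor i = (one -ₛ mono 0 (2 * i)) · (one -ₛ mono 1 (2 * i))

prodUpTo : ℕ → Series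
prodUpTo zero    = one
prodUpTo (suc N) = prodUpTo N · factor (suc N)

-- The infinite product ∏_{i≥1} (1-q^{2i})(1-tq^{2i}) as a formal power
-- series: the coefficient of t^k q^n only depends on factors i ≤ n.
prodInf : Series
prodInf k n = prodUpTo n k n

PSet : ℤ → ℕ → ℕ → Set
PSet j k n = Σ (List ℕ) (λ μ → IsPartition μ × InP j μ × size μ ≡ n × h20 μ ≡ k)

{-# OPTIONS --safe #-}

-- Write e(n) ∈ {0, 1} for the parity of n.  The quantity h_{2,0}(μ) is the sum of ⌊(μᵢ - μᵢ₊₁)/2⌋,
-- and the 2-core is determined by the charge c(μ) = e(μ₁) - e(μ₂) + e(μ₃) - ⋯, which removing a
-- domino preserves and which on a staircase of size binom(2j, 2) equals j.  Let G_N^j be the generating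
-- function of the partitions with charge j and at most N rows.  Distinguishing whether the last row is
-- 0, 1 or at least 2 gives
--   (1 - t q^{2(N+1)}) G_{N+1}^j = G_N^j + q^{N+1} G_N^{e(N+1)-j},
-- so the t-dependence splits off as 1 / ∏_{i≤N} (1 - t q^{2i}), and the remaining factor satisfies a
-- Pascal recurrence solved by q^{binom(2j,2)} times a q²-binomial coefficient.  Modulo q^{n+1} that
-- coefficient is 1 / ∏_i (1 - q^{2i}) once N is large.
module Submission where

open import Defs
open import Algebra.Bundles using (CommutativeRing)
import Algebra.Properties.AbelianGroup as AbelianGroupProperties
import Algebra.Properties.CommutativeSemigroup as CommutativeSemigroupProperties
import Algebra.Properties.Ring as RingProperties
import Algebra.Solver.Ring.NaturalCoefficients.Default as SemiringSolver
open import Data.Bool using (Bool; true; false; if_then_else_; _∧_; not)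
open import Data.Empty using (⊥)
open import Data.Fin using (Fin; zero)
open import Data.Fin.Permutation using (↔⇒≡)
open import Data.Fin.Properties using (+↔⊎)
open import Data.Integer as ℤ using (ℤ; +_; -[1+_]; ∣_∣)
import Data.Integer.Properties as ℤ
import Data.Integer.Tactic.RingSolver as ℤ-Solver
open import Data.List using (List; []; _∷_; _++_; length; map; concatMap; upTo; applyUpTo; zip; drop)
import Data.List.Properties as List
open import Data.List.Relation.Unary.All as All using ([]; _∷_)
open import Data.List.Relation.Unary.Linked as Linked using ([]; [-]; _∷_)
open import Data.Maybe using (Maybe; just; nothing)
open import Data.Nat as ℕ
  using (ℕ; zero; suc; _∸_; _≤_; _<_; z≤n; s≤s; _≡ᵇ_; _<ᵇ_; _≤ᵇ_; ⌊_/2⌋)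
import Data.Nat.Properties as ℕ
import Data.Nat.Tactic.RingSolver as ℕ-Solver
open import Data.Product using (∃; Σ; _×_; _,_; proj₁; proj₂)
open import Data.Product.Function.Dependent.Propositional using () renaming (cong to Σ-cong)
open import Data.Product.Properties using (Σ-≡,≡→≡)
open import Data.Sum using (_⊎_; inj₁; inj₂)
open import Data.Sum.Function.Propositional using (_⊎-cong_)
open import Data.Vec as Vec using (Vec; []; _∷_; _∷ʳ_; initLast; init; last)
import Data.Vec.Properties as Vec
open import Function using (_∘_)
open import Function.Bundles using (_↔_; mk↔ₛ′)
open import Function.Properties.Inverse using (↔-refl; ↔-sym; ↔-trans)
open import Function.Related.TypeIsomorphisms using (Σ-distribʳ-⊎)
open import Relation.Binary.PropositionalEquality as ≡ using (_≡_; cong; cong₂)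
import Relation.Binary.Reasoning.Setoid as SetoidReasoning
open import Relation.Nullary using (Dec; yes; no; ¬_; Irrelevant; contradiction; ofʸ; ofⁿ)
open import Relation.Nullary.Decidable using (_×-dec_)
open import Relation.Nullary.Reflects using (fromEquivalence; _×-reflects_)

-- Formal power series over a commutative ring.

-- Multiplication by the a-th power of the variable.
shift : ∀ {ℓ} {A : Set ℓ} → A → ℕ → (ℕ → A) → ℕ → A
shift 0# zero    f n       = f n
shift 0# (suc a) f zero    = 0#
shift 0# (suc a) f (suc n) = shift 0# a f n

module PowerSeries {c ℓ} (R : CommutativeRing c ℓ) where
  open CommutativeRing R
  open CommutativeSemigroupProperties +-commutativeSemigroup
    using (interchange; x∙yz≈y∙xz)
  open SetoidReasoning setoid

  infix  4 _≋_
  infixl 7 _⊛_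
  infixl 6 _⊕_

  _≋_ : (f g : ℕ → Carrier) → Set ℓ
  f ≋ g = ∀ n → f n ≈ g n

  _⊕_ : (f g : ℕ → Carrier) → ℕ → Carrier
  (f ⊕ g) n = f n + g n

  -- The Cauchy product, from f = f 0 + X · (f ∘ suc).
  _⊛_ : (f g : ℕ → Carrier) → ℕ → Carrier
  (f ⊛ g) zero    = f 0 * g 0
  (f ⊛ g) (suc n) = f 0 * g (suc n) + ((f ∘ suc) ⊛ g) n

  constant : Carrier → ℕ → Carrier
  constant x zero    = x
  constant x (suc n) = 0#

  ⊛-cong : ∀ {f f′ g g′} → f ≋ f′ → g ≋ g′ → f ⊛ g ≋ f′ ⊛ g′
  ⊛-cong p q zero    = *-cong (p 0) (q 0)
  ⊛-cong p q (suc n) = +-cong (*-cong (p 0) (q (suc n))) (⊛-cong (p ∘ suc) q n)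

  ⊛-zeroˡ : ∀ g → (λ _ → 0#) ⊛ g ≋ λ _ → 0#
  ⊛-zeroˡ g zero    = zeroˡ _
  ⊛-zeroˡ g (suc n) = trans (+-cong (zeroˡ _) (⊛-zeroˡ g n)) (+-identityˡ 0#)

  constant-⊛ : ∀ x g → constant x ⊛ g ≋ λ n → x * g n
  constant-⊛ x g zero    = refl
  constant-⊛ x g (suc n) = trans (+-congˡ (⊛-zeroˡ g n)) (+-identityʳ _)

  ⊛-distribʳ : ∀ h f g → (f ⊕ g) ⊛ h ≋ (f ⊛ h) ⊕ (g ⊛ h)
  ⊛-distribʳ h f g zero    = distribʳ _ _ _
  ⊛-distribʳ h f g (suc n) =
    trans (+-cong (distribʳ _ _ _) (⊛-distribʳ h (f ∘ suc) (g ∘ suc) n)) (interchange _ _ _ _)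

  scale-⊛ : ∀ x f g → (λ n → x * f n) ⊛ g ≋ λ n → x * (f ⊛ g) n
  scale-⊛ x f g zero    = *-assoc _ _ _
  scale-⊛ x f g (suc n) =
    trans (+-cong (*-assoc _ _ _) (scale-⊛ x (f ∘ suc) g n)) (sym (distribˡ _ _ _))

  -- The mirror image of the defining recursion, splitting off `g 0` in place of `f 0`; with it
  -- commutativity becomes an induction.
  ⊛-sucʳ : ∀ f g n → (f ⊛ g) (suc n) ≈ f (suc n) * g 0 + (f ⊛ (g ∘ suc)) n
  ⊛-sucʳ f g zero    = +-comm _ _
  ⊛-sucʳ f g (suc n) = trans (+-congˡ (⊛-sucʳ (f ∘ suc) g n)) (x∙yz≈y∙xz _ _ _)

  ⊛-comm : ∀ f g → f ⊛ g ≋ g ⊛ f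
  ⊛-comm f g zero    = *-comm _ _
  ⊛-comm f g (suc n) =
    trans (+-cong (*-comm _ _) (⊛-comm (f ∘ suc) g n)) (sym (⊛-sucʳ g f n))

  ⊛-assoc : ∀ f g h → (f ⊛ g) ⊛ h ≋ f ⊛ (g ⊛ h)
  ⊛-assoc f g h zero    = *-assoc _ _ _
  ⊛-assoc f g h (suc n) = begin
    f 0 * g 0 * h (suc n) + ((λ m → f 0 * g (suc m) + (f′ ⊛ g) m) ⊛ h) n
      ≈⟨ +-cong (*-assoc _ _ _) (⊛-distribʳ h (λ m → f 0 * g (suc m)) (f′ ⊛ g) n) ⟩
    f 0 * (g 0 * h (suc n)) + (((λ m → f 0 * g (suc m)) ⊛ h) n + ((f′ ⊛ g) ⊛ h) n)
      ≈⟨ +-congˡ (+-cong (scale-⊛ (f 0) (g ∘ suc) h n) (⊛-assoc f′ g h n)) ⟩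
    f 0 * (g 0 * h (suc n)) + (f 0 * ((g ∘ suc) ⊛ h) n + (f′ ⊛ (g ⊛ h)) n)
      ≈⟨ +-assoc _ _ _ ⟨
    f 0 * (g 0 * h (suc n)) + f 0 * ((g ∘ suc) ⊛ h) n + (f′ ⊛ (g ⊛ h)) n
      ≈⟨ +-congʳ (distribˡ _ _ _) ⟨
    f 0 * (g ⊛ h) (suc n) + (f′ ⊛ (g ⊛ h)) n ∎
    where f′ = f ∘ suc

  ⊛-identityˡ : ∀ g → constant 1# ⊛ g ≋ g
  ⊛-identityˡ g n = trans (constant-⊛ 1# g n) (*-identityˡ _)

  shift-⊛ : ∀ a f g → shift 0# a f ⊛ g ≋ shift 0# a (f ⊛ g)
  shift-⊛ zero    f g n       = refl
  shift-⊛ (suc a) f g zero    = zeroˡ _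
  shift-⊛ (suc a) f g (suc n) =
    trans (+-congʳ (zeroˡ _)) (trans (+-identityˡ _) (shift-⊛ a f g n))

  powerSeries : CommutativeRing c ℓ
  powerSeries = record
    { Carrier = ℕ → Carrier
    ; _≈_ = _≋_
    ; _+_ = _⊕_
    ; _*_ = _⊛_
    ; -_  = λ f n → - f n
    ; 0#  = λ _ → 0#
    ; 1#  = constant 1#
    ; isCommutativeRing = record
      { isRing = record
        { +-isAbelianGroup = record
          { isGroup = record
            { isMonoid = record
              { isSemigroup = record
                { isMagma = record
                  { isEquivalence = record
                    { refl  = λ _ → refl
                    ; sym   = λ p n → sym (p n)
                    ; trans = λ p q n → trans (p n) (q n)
                    }
                  ; ∙-cong = λ p q n → +-cong (p n) (q n)
                  }
                ; assoc = λ f g h n → +-assoc (f n) (g n) (h n)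
                }
              ; identity = (λ f n → +-identityˡ (f n)) , (λ f n → +-identityʳ (f n))
              }
            ; inverse = (λ f n → -‿inverseˡ (f n)) , (λ f n → -‿inverseʳ (f n))
            ; ⁻¹-cong = λ p n → -‿cong (p n)
            }
          ; comm = λ f g n → +-comm (f n) (g n)
          }
        ; *-cong = ⊛-cong
        ; *-assoc = ⊛-assoc
        ; *-identity = ⊛-identityˡ ,
            λ g n → trans (⊛-comm g (constant 1#) n) (⊛-identityˡ g n)
        ; distrib =
            (λ f g h n → trans (⊛-comm f (g ⊕ h) n)
              (trans (⊛-distribʳ f g h n) (+-cong (⊛-comm g f n) (⊛-comm h f n)))) ,
            ⊛-distribʳ
        }
      ; *-comm = ⊛-comm
      }
    }

-- Pascal's rule with cleared denominators.

module PascalStep {c ℓ} (R : CommutativeRing c ℓ) where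
  open CommutativeRing R
  open SemiringSolver commutativeSemiring using (solve; _:=_; _:+_; _:*_)

  -- With x = q^2 this is [N+1, a+1] = [N, a] + x^(a+1) [N, a+1], where N = a + b + 1. Here `p`,
  -- `q`, `r` stand for the products of 1 - x^i up to a, b, N, the factors that follow them are `u`,
  -- `v`, `w`, and `A` is x^(a+1). Over an abstract ring the solver sees only variables.
  pascal : ∀ f₁ f₂ m M M₂ A u v w p q r →
    f₁ * ((q * v) * p) ≈ M * r → f₂ * ((p * u) * q) ≈ M₂ * r →
    m * M₂ ≈ M * A → u + A * v ≈ w →
    (f₁ + m * f₂) * ((p * u) * (q * v)) ≈ M * (r * w)
  pascal f₁ f₂ m M M₂ A u v w p q r h₁ h₂ h₃ h₄ =
    trans (solve 7 (λ f₁ f₂ m p q u v → (f₁ :+ m :* f₂) :* ((p :* u) :* (q :* v)) :=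
             (f₁ :* ((q :* v) :* p)) :* u :+ (m :* (f₂ :* ((p :* u) :* q))) :* v)
             refl f₁ f₂ m p q u v)
      (trans (+-cong (*-congʳ h₁) (*-congʳ (*-congˡ h₂)))
        (trans (solve 7 (λ M M₂ m r u v A → M :* r :* u :+ m :* (M₂ :* r) :* v :=
                  M :* r :* u :+ (m :* M₂) :* r :* v) refl M M₂ m r u v A)
          (trans (+-congˡ (*-congʳ (*-congʳ h₃)))
            (trans (solve 5 (λ M r u v A → M :* r :* u :+ M :* A :* r :* v :=
                      M :* (r :* (u :+ A :* v))) refl M r u v A)
              (*-congˡ (*-congˡ h₄))))))

  -- `pascal-left` and `pascal-right` are the edges a = 0 and b = 0 of the triangle, where one of
  -- the two terms has a charge out of range for N rows and vanishes.
  pascal-left : ∀ f₁ f₂ m M M₂ p r u →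
    f₁ ≈ 0# → f₂ * (1# * p) ≈ M₂ * r → m * M₂ ≈ M →
    (f₁ + m * f₂) * (1# * (p * u)) ≈ M * (r * u)
  pascal-left f₁ f₂ m M M₂ p r u h₁ h₂ h₃ =
    trans (*-congʳ (trans (+-congʳ h₁) (+-identityˡ _)))
      (trans (solve 5 (λ m f₂ e p u → m :* f₂ :* (e :* (p :* u)) := m :* (f₂ :* (e :* p)) :* u)
                refl m f₂ 1# p u)
        (trans (*-congʳ (*-congˡ h₂))
          (trans (solve 4 (λ m M₂ r u → m :* (M₂ :* r) :* u := m :* M₂ :* (r :* u)) refl m M₂ r u)
            (*-congʳ h₃))))

  pascal-right : ∀ f₁ f₂ m M p r u →
    f₁ * (1# * p) ≈ M * r → f₂ ≈ 0# →
    (f₁ + m * f₂) * ((p * u) * 1#) ≈ M * (r * u)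
  pascal-right f₁ f₂ m M p r u h₁ h₂ =
    trans (*-congʳ (trans (+-congˡ (trans (*-congˡ h₂) (zeroʳ m))) (+-identityʳ _)))
      (trans (solve 4 (λ f₁ e p u → f₁ :* ((p :* u) :* e) := f₁ :* (e :* p) :* u) refl f₁ 1# p u)
        (trans (*-congʳ h₁) (*-assoc M r u)))

-- Charges and sizes of staircases.

parity : ℕ → ℤ
parity n = if even? n then + 0 else + 1

-- Enumerates the integers as 0, 1, -1, 2, -2, ..., that is, by increasing binom(2j, 2).
staircaseCharge : ℕ → ℤ
staircaseCharge zero    = + 0
staircaseCharge (suc n) = parity (suc n) ℤ.- staircaseCharge n

triangular : ℕ → ℕ
triangular zero    = 0
triangular (suc n) = suc n ℕ.+ triangular n

parity-double : ∀ m → parity (2 ℕ.* m) ≡ + 0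
parity-double zero    = ≡.refl
parity-double (suc m) = ≡.trans (cong parity (ℕ.*-suc 2 m)) (parity-double m)

parity-suc-double : ∀ m → parity (suc (2 ℕ.* m)) ≡ + 1
parity-suc-double zero    = ≡.refl
parity-suc-double (suc m) =
  ≡.trans (cong (parity ∘ suc) (ℕ.*-suc 2 m)) (parity-suc-double m)

staircaseCharge-odd  : ∀ m → staircaseCharge (suc (2 ℕ.* m)) ≡ + suc m
staircaseCharge-even : ∀ m → staircaseCharge (2 ℕ.* m) ≡ ℤ.- (+ m)

staircaseCharge-odd m =
  ≡.trans (cong₂ ℤ._-_ (parity-suc-double m) (staircaseCharge-even m))
    (cong (ℤ._+_ (+ 1)) (ℤ.neg-involutive (+ m)))

staircaseCharge-even zero    = ≡.refl
staircaseCharge-even (suc m) =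
  ≡.trans (cong staircaseCharge (ℕ.*-suc 2 m))
    (≡.trans (cong₂ ℤ._-_ (parity-double m) (staircaseCharge-odd m)) (ℤ.+-identityˡ _))

-- Allows `j` to be replaced by the number of rows of its core.
staircaseCharge-surjective : ∀ j → ∃ λ i → staircaseCharge i ≡ j
staircaseCharge-surjective (+ zero)  = 0 , ≡.refl
staircaseCharge-surjective (+ suc m) = suc (2 ℕ.* m) , staircaseCharge-odd m
staircaseCharge-surjective -[1+ m ]  = 2 ℕ.* suc m , staircaseCharge-even (suc m)

-- charge a b is (a - b) / 2 if a + b is even and (b - a + 1) / 2 otherwise: this indexing
-- of the possible charges with a + b rows is the one for which the generating function is
-- q ^ coreSize a b times the q²-binomial coefficient [a + b choose a].
charge : ℕ → ℕ → ℤ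
charge zero    b       = staircaseCharge b
charge (suc a) zero    = staircaseCharge a
charge (suc a) (suc b) = charge a b

-- The staircase with charge `charge a b` has b - a rows if a ≤ b and a - b - 1 rows otherwise; this
-- is its size.
coreSize : ℕ → ℕ → ℕ
coreSize zero    b       = triangular b
coreSize (suc a) zero    = triangular a
coreSize (suc a) (suc b) = coreSize a b

-- Both sides belong to the staircase with a - b rows if b ≤ a and b - a - 1 rows otherwise. This
-- lets an induction hypothesis be used with its indices exchanged.
charge-sucˡ : ∀ a b → charge (suc a) b ≡ charge b a
charge-sucˡ zero    zero    = ≡.refl
charge-sucˡ (suc a) zero    = ≡.refl
charge-sucˡ zero    (suc b) = ≡.refl
charge-sucˡ (suc a) (suc b) = charge-sucˡ a b

coreSize-sucˡ : ∀ a b → coreSize (suc a) b ≡ coreSize b a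
coreSize-sucˡ zero    zero    = ≡.refl
coreSize-sucˡ (suc a) zero    = ≡.refl
coreSize-sucˡ zero    (suc b) = ≡.refl
coreSize-sucˡ (suc a) (suc b) = coreSize-sucˡ a b

-- Turns the reflection of the charge in the row recurrence into an exchange of indices, so that the
-- recurrence stays within the family `charge`.
charge-swap : ∀ a b → charge b a ≡ parity (a ℕ.+ b) ℤ.- charge a b
charge-swap zero    zero    = ≡.refl
charge-swap zero    (suc b) = lemma (parity (suc b)) (staircaseCharge b)
  where
  lemma : ∀ x y → y ≡ x ℤ.- (x ℤ.- y)
  lemma = ℤ-Solver.solve-∀
charge-swap (suc a) zero    = cong (λ n → parity (suc n) ℤ.- staircaseCharge a) (≡.sym (ℕ.+-identityʳ a))
charge-swap (suc a) (suc b) =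
  ≡.trans (charge-swap a b)
    (cong (λ n → parity (suc n) ℤ.- charge a b) (≡.sym (ℕ.+-suc a b)))

-- The balance of exponents in Pascal's rule: it converts the q^(N+1) of the row recurrence into the
-- required power of q^2.
coreSize-sucʳ : ∀ a b → suc (a ℕ.+ b) ℕ.+ coreSize a b ≡ coreSize a (suc b) ℕ.+ 2 ℕ.* a
coreSize-sucʳ zero          b       = ≡.sym (ℕ.+-identityʳ _)
coreSize-sucʳ (suc zero)    zero    = ≡.refl
coreSize-sucʳ (suc (suc a)) zero    = lemma a (triangular a)
  where
  lemma : ∀ a t → suc (suc (suc a) ℕ.+ 0) ℕ.+ (suc a ℕ.+ t) ≡ t ℕ.+ 2 ℕ.* suc (suc a)
  lemma = ℕ-Solver.solve-∀
coreSize-sucʳ (suc a)       (suc b) =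
  ≡.trans (lemma₁ a b (coreSize a b)) (≡.trans (cong (2 ℕ.+_) (coreSize-sucʳ a b)) (lemma₂ a _))
  where
  lemma₁ : ∀ a b t → suc (suc a ℕ.+ suc b) ℕ.+ t ≡ 2 ℕ.+ (suc (a ℕ.+ b) ℕ.+ t)
  lemma₁ = ℕ-Solver.solve-∀
  lemma₂ : ∀ a t → 2 ℕ.+ (t ℕ.+ 2 ℕ.* a) ≡ t ℕ.+ 2 ℕ.* suc a
  lemma₂ = ℕ-Solver.solve-∀

-- Along this diagonal both indices grow while the core stays fixed; the final limit is taken in
-- this direction.
charge-diagonal : ∀ n i → charge n (n ℕ.+ i) ≡ staircaseCharge i
charge-diagonal zero    i = ≡.refl
charge-diagonal (suc n) i = charge-diagonal n i

coreSize-diagonal : ∀ n i → coreSize n (n ℕ.+ i) ≡ triangular i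
coreSize-diagonal zero    i = ≡.refl
coreSize-diagonal (suc n) i = coreSize-diagonal n i

triangular-double : ∀ m → triangular (2 ℕ.* m) ≡ m ℕ.* suc (2 ℕ.* m)
triangular-double zero    = ≡.refl
triangular-double (suc m) =
  ≡.trans (cong triangular (ℕ.*-suc 2 m))
    (≡.trans (cong (λ t → suc (suc (2 ℕ.* m)) ℕ.+ (suc (2 ℕ.* m) ℕ.+ t)) (triangular-double m))
      (lemma m))
  where
  lemma : ∀ m → suc (suc (2 ℕ.* m)) ℕ.+ (suc (2 ℕ.* m) ℕ.+ m ℕ.* suc (2 ℕ.* m)) ≡
                suc m ℕ.* suc (2 ℕ.* suc m)
  lemma = ℕ-Solver.solve-∀

even-or-odd : ∀ n → ∃ λ m → n ≡ 2 ℕ.* m ⊎ n ≡ suc (2 ℕ.* m)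
even-or-odd zero    = 0 , inj₁ ≡.refl
even-or-odd (suc n) with even-or-odd n
... | m , inj₁ n≡ = m , inj₂ (cong suc n≡)
... | m , inj₂ n≡ = suc m , inj₁ (≡.trans (cong suc n≡) (≡.sym (ℕ.*-suc 2 m)))

-- The charge is -m for 2m rows and m + 1 for 2m + 1 rows; either value put into j(2j - 1) gives the
-- triangular number.
binom2j-staircaseCharge : ∀ n → binom2j (staircaseCharge n) ≡ + triangular n
binom2j-staircaseCharge n with even-or-odd n
... | m , inj₁ ≡.refl =
  ≡.trans (cong binom2j (staircaseCharge-even m))
    (≡.trans (lemma (+ m)) (≡.trans (cong (λ x → + m ℤ.* (+ 1 ℤ.+ x)) (≡.sym (ℤ.pos-* 2 m)))
      (≡.trans (≡.sym (ℤ.pos-* m (suc (2 ℕ.* m)))) (cong +_ (≡.sym (triangular-double m))))))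
  where
  lemma : ∀ x → ℤ.- x ℤ.* (+ 2 ℤ.* ℤ.- x ℤ.- + 1) ≡ x ℤ.* (+ 1 ℤ.+ + 2 ℤ.* x)
  lemma = ℤ-Solver.solve-∀
... | m , inj₂ ≡.refl =
  ≡.trans (cong binom2j (staircaseCharge-odd m))
    (≡.trans (lemma (+ m)) (≡.trans
      (cong (λ x → (+ 1 ℤ.+ x) ℤ.+ + m ℤ.* (+ 1 ℤ.+ x)) (≡.sym (ℤ.pos-* 2 m)))
      (≡.trans (cong (ℤ._+_ (+ suc (2 ℕ.* m))) (≡.sym (ℤ.pos-* m (suc (2 ℕ.* m)))))
        (cong (λ t → + (suc (2 ℕ.* m) ℕ.+ t)) (≡.sym (triangular-double m))))))
  where
  lemma : ∀ x → (+ 1 ℤ.+ x) ℤ.* (+ 2 ℤ.* (+ 1 ℤ.+ x) ℤ.- + 1) ≡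
                (+ 1 ℤ.+ + 2 ℤ.* x) ℤ.+ x ℤ.* (+ 1 ℤ.+ + 2 ℤ.* x)
  lemma = ℤ-Solver.solve-∀

-- Series in t and q, and their finite products.

module q-Series  = PowerSeries ℤ.+-*-commutativeRing
-- Iterating the construction makes the outer index the exponent of t and the inner one that of q,
-- so the carrier is `Series` itself.
module tq-Series = PowerSeries q-Series.powerSeries

open CommutativeRing tq-Series.powerSeries
  using (_≈_; _+_; _*_; _-_; 0#; 1#; refl; sym; trans; reflexive; +-cong; +-congˡ; *-cong; *-congˡ;
         *-congʳ; *-comm; *-assoc; *-identityˡ; *-identityʳ; distribˡ; zeroʳ; -‿cong)

Σ≤-suc : ∀ n f → Σ≤ (suc n) f ≡ f 0 ℤ.+ Σ≤ n (f ∘ suc)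
Σ≤-suc zero    f = ≡.refl
Σ≤-suc (suc n) f = ≡.trans (cong (ℤ._+ f (2 ℕ.+ n)) (Σ≤-suc n f)) (ℤ.+-assoc (f 0) _ _)

Σ≤-cong : ∀ n {f g} → (∀ m → m ≤ n → f m ≡ g m) → Σ≤ n f ≡ Σ≤ n g
Σ≤-cong zero    p = p 0 z≤n
Σ≤-cong (suc n) p = cong₂ ℤ._+_ (Σ≤-cong n λ m m≤n → p m (ℕ.m≤n⇒m≤1+n m≤n)) (p (suc n) ℕ.≤-refl)

⊛-Σ≤ : ∀ f g n → (f q-Series.⊛ g) n ≡ Σ≤ n (λ b → f b ℤ.* g (n ∸ b))
⊛-Σ≤ f g zero    = ≡.refl
⊛-Σ≤ f g (suc n) =
  ≡.trans (cong (ℤ._+_ (f 0 ℤ.* g (suc n))) (⊛-Σ≤ (f ∘ suc) g n)) (≡.sym (Σ≤-suc n _))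

*-Σ≤ : ∀ F G k n → (F * G) k n ≡ Σ≤ k (λ a → (F a q-Series.⊛ G (k ∸ a)) n)
*-Σ≤ F G zero    n = ≡.refl
*-Σ≤ F G (suc k) n =
  ≡.trans (cong (ℤ._+_ ((F 0 q-Series.⊛ G (suc k)) n)) (*-Σ≤ (F ∘ suc) G k n)) (≡.sym (Σ≤-suc k _))

-- The bridge from the double sum in the statement to the ring multiplication used in all later
-- algebra.
·-* : ∀ F G → F · G ≈ F * G
·-* F G k n = ≡.sym (≡.trans (*-Σ≤ F G k n) (Σ≤-cong k λ a _ → ⊛-Σ≤ (F a) (G (k ∸ a)) n))

-- Generic in the values: it shifts integer coefficients, natural counts, and families of types with
-- `⊥` as zero.
shift₂ : ∀ {ℓ} {A : Set ℓ} → A → ℕ → ℕ → (ℕ → ℕ → A) → ℕ → ℕ → A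
shift₂ 0# a b F = shift (λ _ → 0#) a (λ k → shift 0# b (F k))

shift-cong : ∀ {A : Set} {0# : A} b {f g} n → (∀ m → m ≤ n → f m ≡ g m) →
  shift 0# b f n ≡ shift 0# b g n
shift-cong zero    n       p = p n ℕ.≤-refl
shift-cong (suc b) zero    p = ≡.refl
shift-cong (suc b) (suc n) p = shift-cong b n λ m m≤n → p m (ℕ.m≤n⇒m≤1+n m≤n)

shift-0 : ∀ {A : Set} {0# : A} b n → shift 0# b (λ _ → 0#) n ≡ 0#
shift-0 zero    n       = ≡.refl
shift-0 (suc b) zero    = ≡.refl
shift-0 (suc b) (suc n) = shift-0 b n

shift-+ : ∀ b f g n →
  shift (+ 0) b f n ℤ.+ shift (+ 0) b g n ≡ shift (+ 0) b (λ m → f m ℤ.+ g m) n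
shift-+ zero    f g n       = ≡.refl
shift-+ (suc b) f g zero    = ≡.refl
shift-+ (suc b) f g (suc n) = shift-+ b f g n

q-shift-* : ∀ b F G → shift₂ (+ 0) 0 b F * G ≈ shift₂ (+ 0) 0 b (F * G)
q-shift-* b F G zero    n = q-Series.shift-⊛ b (F 0) (G 0) n
q-shift-* b F G (suc k) n =
  ≡.trans (cong₂ ℤ._+_ (q-Series.shift-⊛ b (F 0) (G (suc k)) n) (q-shift-* b (F ∘ suc) G k n))
          (shift-+ b _ _ n)

one-1# : one ≈ 1#
one-1# zero    zero    = ≡.refl
one-1# zero    (suc n) = ≡.refl
one-1# (suc k) n       = ≡.refl

mono-shift : ∀ a b → mono a b ≈ shift₂ (+ 0) a b 1#
mono-shift zero    b zero    n = lemma b n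
  where
  lemma : ∀ b n → (if b ≡ᵇ n then + 1 else + 0) ≡ shift (+ 0) b (1# 0) n
  lemma zero    zero    = ≡.refl
  lemma zero    (suc n) = ≡.refl
  lemma (suc b) zero    = ≡.refl
  lemma (suc b) (suc n) = lemma b n
mono-shift zero    b (suc k) n = ≡.sym (shift-0 b n)
mono-shift (suc a) b zero    n = ≡.refl
mono-shift (suc a) b (suc k) n = mono-shift a b k n

shift-congˡ : ∀ a {F G : Series} → F ≈ G → shift (λ _ → + 0) a F ≈ shift (λ _ → + 0) a G
shift-congˡ zero    p k       = p k
shift-congˡ (suc a) p zero    = λ _ → ≡.refl
shift-congˡ (suc a) p (suc k) = shift-congˡ a p k

mono-* : ∀ a b F → mono a b * F ≈ shift₂ (+ 0) a b F
mono-* a b F =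
  trans (*-congʳ (mono-shift a b))
    (trans (tq-Series.shift-⊛ a (shift₂ (+ 0) 0 b 1#) F)
      (shift-congˡ a (trans (q-shift-* b 1# F) λ k n →
        shift-cong b n λ m _ → *-identityˡ F k m)))

mono-+ : ∀ b d → mono 0 b * mono 0 d ≈ mono 0 (b ℕ.+ d)
mono-+ b d = trans (mono-* 0 b (mono 0 d)) (lemma b)
  where
  lemma : ∀ b → shift₂ (+ 0) 0 b (mono 0 d) ≈ mono 0 (b ℕ.+ d)
  lemma zero    k       n       = ≡.refl
  lemma (suc b) zero    zero    = ≡.refl
  lemma (suc b) (suc k) zero    = ≡.refl
  lemma (suc b) zero    (suc n) = lemma b zero n
  lemma (suc b) (suc k) (suc n) = lemma b (suc k) n

q-factor : ℕ → Series
q-factor i = one -ₛ mono 0 (2 ℕ.* i)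

tq-factor : ℕ → Series
tq-factor i = one -ₛ mono 1 (2 ℕ.* i)

q-product : ℕ → Series
q-product zero    = 1#
q-product (suc N) = q-product N * q-factor (suc N)

tq-product : ℕ → Series
tq-product zero    = 1#
tq-product (suc N) = tq-product N * tq-factor (suc N)

module *-Semigroup = CommutativeSemigroupProperties
  (CommutativeRing.*-commutativeSemigroup tq-Series.powerSeries)

-- The two halves meet different fates: `tq-product` removes t from the generating function, while
-- `q-product` is matched with the limit of the binomial coefficient.
prodUpTo-split : ∀ N → prodUpTo N ≈ tq-product N * q-product N
prodUpTo-split zero    = trans one-1# (sym (*-identityˡ 1#))
prodUpTo-split (suc N) =
  trans (·-* (prodUpTo N) (factor (suc N)))
    (trans (*-cong (prodUpTo-split N)
             (trans (·-* (q-factor (suc N)) (tq-factor (suc N)))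
                    (*-comm (q-factor (suc N)) (tq-factor (suc N)))))
      (*-Semigroup.interchange (tq-product N) (q-product N) (tq-factor (suc N)) (q-factor (suc N))))

-- Congruence modulo a power of q, stability and cancellation.

infix 4 _≈[_]_
-- Congruence modulo q^(n+1), with the exponent of t unrestricted.
_≈[_]_ : Series → ℕ → Series → Set
F ≈[ n ] G = ∀ k m → m ≤ n → F k m ≡ G k m

*-cong[] : ∀ n {F F′ G G′} → F ≈[ n ] F′ → G ≈[ n ] G′ → F * G ≈[ n ] F′ * G′
*-cong[] n {F} {F′} {G} {G′} p q k m m≤n =
  ≡.trans (≡.sym (·-* F G k m)) (≡.trans
    (Σ≤-cong k λ a _ → Σ≤-cong m λ b b≤m →
      cong₂ ℤ._*_ (p a b (ℕ.≤-trans b≤m m≤n))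
                  (q (k ∸ a) (m ∸ b) (ℕ.≤-trans (ℕ.m∸n≤m m b) m≤n)))
    (·-* F′ G′ k m))

mono≈[] : ∀ a b n → n < b → mono a b ≈[ n ] λ _ _ → + 0
mono≈[] (suc a) b       n n<b zero    m       m≤n = ≡.refl
mono≈[] (suc a) b       n n<b (suc k) m       m≤n = mono≈[] a b n n<b k m m≤n
mono≈[] zero    b       n n<b (suc k) m       m≤n = ≡.refl
mono≈[] zero    (suc b) n n<b zero    zero    m≤n = ≡.refl
mono≈[] zero    (suc b) (suc n) (s≤s n<b) zero (suc m) (s≤s m≤n) = mono≈[] zero b n n<b zero m m≤n

one-mono≈[] : ∀ a i n → n < i → one -ₛ mono a (2 ℕ.* i) ≈[ n ] 1#
one-mono≈[] a i n n<i k m m≤n =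
  ≡.trans (cong₂ ℤ._-_ (one-1# k m)
            (mono≈[] a (2 ℕ.* i) n (ℕ.<-≤-trans n<i (ℕ.m≤m+n i _)) k m m≤n))
          (ℤ.+-identityʳ _)

-- Factors with index above n are 1 modulo q^(n+1), so appending `l` of them is invisible there.
product-stable : ∀ (P f : ℕ → Series) → (∀ N → P (suc N) ≈ P N * f (suc N)) →
  (∀ i n → n < i → f i ≈[ n ] 1#) → ∀ n l → P (l ℕ.+ n) ≈[ n ] P n
product-stable P f P-suc f≈1 n zero    k m m≤n = ≡.refl
product-stable P f P-suc f≈1 n (suc l) k m m≤n =
  ≡.trans (P-suc (l ℕ.+ n) k m) (≡.trans
    (*-cong[] n {G = f (suc (l ℕ.+ n))} {G′ = 1#} (product-stable P f P-suc f≈1 n l)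
      (f≈1 _ n (s≤s (ℕ.m≤n+m n l))) k m m≤n)
    (*-identityʳ (P n) k m))

q-product-stable : ∀ n l → q-product (l ℕ.+ n) ≈[ n ] q-product n
q-product-stable = product-stable q-product q-factor (λ N → refl) (one-mono≈[] 0)

-- `prodInf` cuts the product at a place depending on the coefficient; stability replaces all these
-- cuts by a single one.
prodInf≈[] : ∀ n l → prodInf ≈[ n ] prodUpTo (l ℕ.+ n)
prodInf≈[] n l k m m≤n = ≡.trans (≡.sym (product-stable prodUpTo factor
    (λ N → ·-* (prodUpTo N) (factor (suc N)))
    (λ i n n<i k m m≤n → ≡.trans (·-* (q-factor i) (tq-factor i) k m)
      (≡.trans (*-cong[] n (one-mono≈[] 0 i n n<i) (one-mono≈[] 1 i n n<i) k m m≤n)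
               (*-identityˡ 1# k m)))
    m (l ℕ.+ n ∸ m) k m ℕ.≤-refl))
  (cong (λ N → prodUpTo N k m) (ℕ.m∸n+n≡m (ℕ.≤-trans m≤n (ℕ.m≤n+m n l))))

module *-Ring = RingProperties (CommutativeRing.ring tq-Series.powerSeries)

one-mono-* : ∀ a b F → (one -ₛ mono a b) * F ≈ F - shift₂ (+ 0) a b F
one-mono-* a b F =
  trans (*-Ring.[y-z]x≈yx-zx F one (mono a b))
    (+-cong (trans (*-congʳ one-1#) (*-identityˡ F))
            (λ k n → cong ℤ.-_ (mono-* a b F k n)))

shift-cong-< : ∀ {A : Set} {0# : A} b {f g} n → (∀ m → m < n → f m ≡ g m) →
  shift 0# (suc b) f n ≡ shift 0# (suc b) g n
shift-cong-< b zero    p = ≡.refl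
shift-cong-< b (suc n) p = shift-cong b n λ m m≤n → p m (s≤s m≤n)

-- Multiplication by 1 - q^(b+1) changes the coefficient of q^m only by a coefficient of strictly
-- lower order, so strong induction on m recovers the other factor, even after truncation.
one-mono-cancel : ∀ b n {F G} → F * (one -ₛ mono 0 (suc b)) ≈[ n ] G * (one -ₛ mono 0 (suc b)) →
  F ≈[ n ] G
one-mono-cancel b n {F} {G} p k m m≤n = below (suc m) m ℕ.≤-refl m≤n
  where
  p′ : ∀ m → m ≤ n →
    F k m ℤ.- shift (+ 0) (suc b) (F k) m ≡ G k m ℤ.- shift (+ 0) (suc b) (G k) m
  p′ m m≤n = ≡.trans (≡.sym (commuted F)) (≡.trans (p k m m≤n) (commuted G))
    where
    commuted : ∀ H → (H * (one -ₛ mono 0 (suc b))) k m ≡ H k m ℤ.- shift (+ 0) (suc b) (H k) m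
    commuted H = ≡.trans (*-comm H (one -ₛ mono 0 (suc b)) k m) (one-mono-* 0 (suc b) H k m)
  below : ∀ l m → m < l → m ≤ n → F k m ≡ G k m
  below (suc l) m (s≤s m≤l) m≤n =
    ∙-cancelʳ _ _ _ (≡.trans (p′ m m≤n)
      (cong (λ x → G k m ℤ.- x) (≡.sym (shift-cong-< b m λ i i<m →
        below l i (ℕ.<-≤-trans i<m m≤l) (ℕ.≤-trans (ℕ.<⇒≤ i<m) m≤n)))))
    where open AbelianGroupProperties ℤ.+-0-abelianGroup using (∙-cancelʳ)

q-product-cancel : ∀ N n {F G} → F * q-product N ≈[ n ] G * q-product N → F ≈[ n ] G
q-product-cancel zero    n {F} {G} p k m m≤n =
  ≡.trans (≡.sym (*-identityʳ F k m)) (≡.trans (p k m m≤n) (*-identityʳ G k m))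
q-product-cancel (suc N) n {F} {G} p =
  q-product-cancel N n (one-mono-cancel _ n λ k m m≤n →
    ≡.trans (*-assoc F (q-product N) (q-factor (suc N)) k m)
      (≡.trans (p k m m≤n) (≡.sym (*-assoc G (q-product N) (q-factor (suc N)) k m))))

-- The solution of the row recurrence by q^2-binomial coefficients.

open PascalStep tq-Series.powerSeries

mono-mono : ∀ {b d e} → b ℕ.+ d ≡ e → mono 0 b * mono 0 d ≈ mono 0 e
mono-mono {b} {d} ≡.refl = mono-+ b d

q-factor-+ : ∀ i j → q-factor i + mono 0 (2 ℕ.* i) * q-factor j ≈ q-factor (i ℕ.+ j)
q-factor-+ i j =
  trans (+-congˡ {q-factor i} (trans (*-Ring.x[y-z]≈xy-xz A one B)
           (+-cong (trans (*-congˡ one-1#) (*-identityʳ A))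
                   (-‿cong (mono-mono {2 ℕ.* i} {2 ℕ.* j} (≡.sym (ℕ.*-distribˡ-+ 2 i j)))))))
    λ k n → lemma (one k n) (A k n) (mono 0 (2 ℕ.* (i ℕ.+ j)) k n)
  where
  A = mono 0 (2 ℕ.* i)
  B = mono 0 (2 ℕ.* j)
  lemma : ∀ x y z → (x ℤ.- y) ℤ.+ (y ℤ.- z) ≡ x ℤ.- z
  lemma = ℤ-Solver.solve-∀

-- Isolates what is needed of the t-free generating function: initial value, row recurrence, and the
-- zeros just outside Pascal's triangle.
module _ (f : ℕ → ℤ → Series)
  (f-zero : f 0 (+ 0) ≈ 1#)
  (f-suc : ∀ N D → f (suc N) D ≈ f N D + mono 0 (suc N) * f N (parity (suc N) ℤ.- D))
  (f-vanishes : ∀ N → f N (staircaseCharge (suc N)) ≈ 0#)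
  where

  -- f (a + b) (charge a b) is q ^ coreSize a b times the q²-binomial coefficient [a + b choose a],
  -- with the denominator cleared; the induction step is Pascal's rule.
  finite-form : ∀ N a b → a ℕ.+ b ≡ N →
    f N (charge a b) * (q-product a * q-product b) ≈ mono 0 (coreSize a b) * q-product N
  finite-form zero    zero    zero    _  =
    trans (*-cong f-zero (*-identityˡ 1#)) (*-congʳ (sym one-1#))
  finite-form (suc N) zero    (suc b) eq with ℕ.suc-injective eq
  ... | ≡.refl =
    trans (*-congʳ (f-suc b _))
      (pascal-left _ _ (mono 0 (suc b)) _ (mono 0 (triangular b)) (q-product b) _ (q-factor (suc b))
        (f-vanishes b)
        (trans (*-congʳ (reflexive (cong (f b) charge-b))) (finite-form b 0 b ≡.refl))
        (mono-+ (suc b) (triangular b)))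
    where
    charge-b : parity (suc b) ℤ.- staircaseCharge (suc b) ≡ staircaseCharge b
    charge-b = ≡.sym (charge-swap 0 (suc b))
  finite-form (suc N) (suc a) zero    eq with ≡.trans (≡.sym (ℕ.+-identityʳ a)) (ℕ.suc-injective eq)
  ... | ≡.refl =
    trans (*-congʳ (f-suc a _))
      (pascal-right (f a (staircaseCharge a)) (f a (staircaseCharge (suc a)))
        (mono 0 (suc a)) (mono 0 (triangular a)) (q-product a) (q-product a) (q-factor (suc a))
        -- The index pair is (0, a) because `charge (suc a) 0` unfolds to `charge 0 a`; the
        -- reflected charge unfolds to `staircaseCharge (suc a)`, where `f a` vanishes.
        (finite-form a 0 a ≡.refl) (f-vanishes a))
  finite-form (suc N) (suc a) (suc b) eq =
    trans (*-congʳ (f-suc N _))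
      (pascal _ _ (mono 0 (suc N)) _ (mono 0 (coreSize (suc a) b)) (mono 0 (2 ℕ.* suc a))
        (q-factor (suc a)) (q-factor (suc b)) _ (q-product a) (q-product b) (q-product N)
        -- The entry [N, a] is reached as the pair (b + 1, a), which has the same core as (a, b).
        (trans (*-congʳ (reflexive (cong (f N) (≡.sym (charge-sucˡ b a)))))
          (trans (finite-form N (suc b) a (≡.trans (cong suc (ℕ.+-comm b a)) a+b))
            (*-congʳ (reflexive (cong (mono 0) (coreSize-sucˡ b a))))))
        (trans (*-congʳ (reflexive (cong (f N) charge-a)))
          (finite-form N (suc a) b a+b))
        (trans (mono-mono {suc N} {coreSize (suc a) b}
                 (≡.trans (cong (λ n → suc n ℕ.+ coreSize (suc a) b) (≡.sym a+b))
                          (coreSize-sucʳ (suc a) b)))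
          (sym (mono-+ (coreSize a b) (2 ℕ.* suc a))))
        (trans (q-factor-+ (suc a) (suc b)) (reflexive (cong q-factor eq))))
    where
    a+b : suc (a ℕ.+ b) ≡ N
    a+b = ≡.trans (≡.sym (ℕ.+-suc a b)) (ℕ.suc-injective eq)
    charge-a : parity (suc N) ℤ.- charge a b ≡ charge (suc a) b
    charge-a = ≡.trans (cong (λ n → parity (suc n) ℤ.- charge a b) (≡.sym a+b))
                 (≡.sym (≡.trans (charge-sucˡ a b) (charge-swap a b)))

-- Partitions as vectors of row differences.

parity-suc : ∀ n → parity (suc n) ≡ + 1 ℤ.- parity n
parity-suc zero          = ≡.refl
parity-suc (suc zero)    = ≡.refl
parity-suc (suc (suc n)) = parity-suc n

-- A vector of length N stands for the partition with at most N rows whose i-th row exceeds the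
-- next one by the i-th entry.
vSize : ∀ {N} → Vec ℕ N → ℕ
vSize []       = 0
vSize (x ∷ xs) = (x ℕ.+ Vec.sum xs) ℕ.+ vSize xs

vPairs : ∀ {N} → Vec ℕ N → ℕ
vPairs []       = 0
vPairs (x ∷ xs) = ⌊ x /2⌋ ℕ.+ vPairs xs

vCharge : ∀ {N} → Vec ℕ N → ℤ
vCharge []       = + 0
vCharge (x ∷ xs) = parity (x ℕ.+ Vec.sum xs) ℤ.- vCharge xs

sum-∷ʳ : ∀ {N} (xs : Vec ℕ N) y → Vec.sum (xs ∷ʳ y) ≡ y ℕ.+ Vec.sum xs
sum-∷ʳ []       y = ≡.refl
sum-∷ʳ (x ∷ xs) y = ≡.trans (cong (x ℕ.+_) (sum-∷ʳ xs y)) (lemma x y _)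
  where
  lemma : ∀ x y s → x ℕ.+ (y ℕ.+ s) ≡ y ℕ.+ (x ℕ.+ s)
  lemma = ℕ-Solver.solve-∀

-- The last difference counts the columns of full height N + 1.
vSize-∷ʳ : ∀ {N} (xs : Vec ℕ N) y → vSize (xs ∷ʳ y) ≡ y ℕ.* suc N ℕ.+ vSize xs
vSize-∷ʳ         []       y = cong (ℕ._+ 0) (≡.trans (ℕ.+-identityʳ y) (≡.sym (ℕ.*-identityʳ y)))
vSize-∷ʳ {suc N} (x ∷ xs) y =
  ≡.trans (cong₂ (λ s t → x ℕ.+ s ℕ.+ t) (sum-∷ʳ xs y) (vSize-∷ʳ xs y))
    (lemma x y N (Vec.sum xs) (vSize xs))
  where
  lemma : ∀ x y N s t →
    x ℕ.+ (y ℕ.+ s) ℕ.+ (y ℕ.* suc N ℕ.+ t) ≡ y ℕ.* suc (suc N) ℕ.+ (x ℕ.+ s ℕ.+ t)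
  lemma = ℕ-Solver.solve-∀

vPairs-∷ʳ : ∀ {N} (xs : Vec ℕ N) y → vPairs (xs ∷ʳ y) ≡ ⌊ y /2⌋ ℕ.+ vPairs xs
vPairs-∷ʳ []       y = ≡.refl
vPairs-∷ʳ (x ∷ xs) y = ≡.trans (cong (⌊ x /2⌋ ℕ.+_) (vPairs-∷ʳ xs y)) (lemma ⌊ x /2⌋ ⌊ y /2⌋ _)
  where
  lemma : ∀ x y s → x ℕ.+ (y ℕ.+ s) ≡ y ℕ.+ (x ℕ.+ s)
  lemma = ℕ-Solver.solve-∀

parity-sum-∷ʳ : ∀ {N} x (xs : Vec ℕ N) y →
  parity (x ℕ.+ Vec.sum (xs ∷ʳ y)) ≡ parity (y ℕ.+ (x ℕ.+ Vec.sum xs))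
parity-sum-∷ʳ x xs y = cong parity (sum-∷ʳ (x ∷ xs) y)

vCharge-∷ʳ-0 : ∀ {N} (xs : Vec ℕ N) → vCharge (xs ∷ʳ 0) ≡ vCharge xs
vCharge-∷ʳ-0 []       = ≡.refl
vCharge-∷ʳ-0 (x ∷ xs) = cong₂ ℤ._-_ (parity-sum-∷ʳ x xs 0) (vCharge-∷ʳ-0 xs)

-- A full column turns each row parity e into 1 - e, and the alternating sum of N + 1 ones is
-- `parity (suc N)`.
vCharge-∷ʳ-1 : ∀ {N} (xs : Vec ℕ N) → vCharge (xs ∷ʳ 1) ≡ parity (suc N) ℤ.- vCharge xs
vCharge-∷ʳ-1 []       = ≡.refl
vCharge-∷ʳ-1 {suc N} (x ∷ xs) =
  ≡.trans (cong₂ ℤ._-_ (≡.trans (parity-sum-∷ʳ x xs 1) (parity-suc (x ℕ.+ Vec.sum xs)))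
                       (vCharge-∷ʳ-1 xs))
    (≡.trans (lemma (parity (x ℕ.+ Vec.sum xs)) (parity (suc N)) (vCharge xs))
      (cong (ℤ._- (parity (x ℕ.+ Vec.sum xs) ℤ.- vCharge xs)) (≡.sym (parity-suc (suc N)))))
  where
  lemma : ∀ p r c → (+ 1 ℤ.- p) ℤ.- (r ℤ.- c) ≡ (+ 1 ℤ.- r) ℤ.- (p ℤ.- c)
  lemma = ℤ-Solver.solve-∀

vCharge-∷ʳ-2+ : ∀ {N} (xs : Vec ℕ N) y → vCharge (xs ∷ʳ suc (suc y)) ≡ vCharge (xs ∷ʳ y)
vCharge-∷ʳ-2+ []       y = ≡.refl
vCharge-∷ʳ-2+ (x ∷ xs) y =
  cong₂ ℤ._-_ (≡.trans (parity-sum-∷ʳ x xs (suc (suc y))) (≡.sym (parity-sum-∷ʳ x xs y)))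
              (vCharge-∷ʳ-2+ xs y)

parity-bounds : ∀ n → + 0 ℤ.≤ parity n × parity n ℤ.≤ + 1
parity-bounds zero          = ℤ.+≤+ z≤n , ℤ.+≤+ z≤n
parity-bounds (suc zero)    = ℤ.+≤+ z≤n , ℤ.+≤+ (s≤s z≤n)
parity-bounds (suc (suc n)) = parity-bounds n

-- Of the N signs in the alternating sum, half rounded up are positive and half rounded down are
-- negative.
vCharge-bounds : ∀ {N} (xs : Vec ℕ N) →
  ℤ.- (+ ⌊ N /2⌋) ℤ.≤ vCharge xs × vCharge xs ℤ.≤ + ⌊ suc N /2⌋
vCharge-bounds []       = ℤ.≤-refl , ℤ.≤-refl
vCharge-bounds {suc N} (x ∷ xs) with parity-bounds (x ℕ.+ Vec.sum xs) | vCharge-bounds xs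
... | 0≤p , p≤1 | lower , upper =
  ≡.subst (ℤ._≤ vCharge (x ∷ xs)) (ℤ.+-identityˡ _) (ℤ.+-mono-≤ 0≤p (ℤ.neg-mono-≤ upper)) ,
  ℤ.+-mono-≤ p≤1 (≡.subst (ℤ.- vCharge xs ℤ.≤_) (ℤ.neg-involutive _) (ℤ.neg-mono-≤ lower))

half-suc-double : ∀ m → ⌊ suc (2 ℕ.* m) /2⌋ ≡ m
half-suc-double zero    = ≡.refl
half-suc-double (suc m) = ≡.trans (cong (⌊_/2⌋ ∘ suc) (ℕ.*-suc 2 m)) (cong suc (half-suc-double m))

-- A partition with at most N rows cannot have the staircase with N + 1 rows as its core.
vCharge≢staircaseCharge : ∀ {N} (xs : Vec ℕ N) → ¬ vCharge xs ≡ staircaseCharge (suc N)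
vCharge≢staircaseCharge {N} xs eq with even-or-odd N | vCharge-bounds xs
... | m , inj₁ ≡.refl | _ , upper =
  ℕ.<-irrefl ≡.refl (≡.subst (suc m ≤_) (half-suc-double m) (ℤ.drop‿+≤+
    (≡.subst (ℤ._≤ + ⌊ suc (2 ℕ.* m) /2⌋) (≡.trans eq (staircaseCharge-odd m)) upper)))
... | m , inj₂ ≡.refl | lower , _ =
  ℕ.<-irrefl ≡.refl (≡.subst (suc m ≤_) (half-suc-double m) (ℤ.drop‿+≤+ (ℤ.neg-cancel-≤
    (≡.subst (ℤ.- (+ ⌊ suc (2 ℕ.* m) /2⌋) ℤ.≤_)
      (≡.trans eq (≡.trans (cong staircaseCharge (≡.sym (ℕ.*-suc 2 m))) (staircaseCharge-even (suc m))))
      lower))))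

-- The row recurrence as a bijection.

Fiber : {X : Set} → (X → ℕ) → (X → ℕ) → (X → ℤ) → ℤ → ℕ → ℕ → Set
Fiber s w h D k n = ∃ λ x → s x ≡ k × w x ≡ n × h x ≡ D

×-irrelevant : {A B C : Set} {a a′ : A} {b b′ : B} {c c′ : C} →
  Irrelevant (a ≡ a′ × b ≡ b′ × c ≡ c′)
×-irrelevant (≡.refl , ≡.refl , ≡.refl) (≡.refl , ≡.refl , ≡.refl) = ≡.refl

irrelevant-↔ : {A B : Set} → Irrelevant A → Irrelevant B → (A → B) → (B → A) → A ↔ B
irrelevant-↔ irrA irrB f g = mk↔ₛ′ f g (λ _ → irrB _ _) (λ _ → irrA _ _)

-- Serves finiteness, enumeration and the cast to integers alike. The equation given to the premise
-- records that the exponent of q drops by `b`, which `VFiber-finite` needs for its descent.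
shift₂-rel : ∀ {a b r} {A : Set a} {B : Set b} (R : A → B → Set r) {0A 0B} → R 0A 0B →
  ∀ a b {F : ℕ → ℕ → A} {G : ℕ → ℕ → B} k n →
  (∀ k′ n′ → n′ ℕ.+ b ≡ n → R (F k′ n′) (G k′ n′)) → R (shift₂ 0A a b F k n) (shift₂ 0B a b G k n)
shift₂-rel R R0 (suc a) b       zero    n       p = R0
shift₂-rel R R0 (suc a) b       (suc k) n       p = shift₂-rel R R0 a b k n p
shift₂-rel R R0 zero    zero    k       n       p = p k n (ℕ.+-identityʳ n)
shift₂-rel R R0 zero    (suc b) k       zero    p = R0
shift₂-rel R R0 zero    (suc b) k       (suc n) p =
  shift₂-rel R R0 zero b k n λ k′ n′ eq → p k′ n′ (≡.trans (ℕ.+-suc n′ b) (cong suc eq))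

shift₂-Fiber : ∀ {X : Set} (s w : X → ℕ) (h : X → ℤ) D a b k n →
  shift₂ ⊥ a b (Fiber s w h D) k n ↔ Fiber (λ x → a ℕ.+ s x) (λ x → b ℕ.+ w x) h D k n
shift₂-Fiber s w h D zero zero k n = ↔-refl
shift₂-Fiber s w h D (suc a) b zero n =
  mk↔ₛ′ (λ ()) (λ ()) (λ ()) (λ ())
shift₂-Fiber s w h D zero (suc b) k zero =
  mk↔ₛ′ (λ ()) (λ ()) (λ ()) (λ ())
shift₂-Fiber s w h D (suc a) b (suc k) n =
  ↔-trans (shift₂-Fiber s w h D a b k n) (Σ-cong ↔-refl
    (irrelevant-↔ ×-irrelevant ×-irrelevant
      (λ (p , q , r) → cong suc p , q , r) (λ (p , q , r) → ℕ.suc-injective p , q , r)))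
shift₂-Fiber s w h D zero (suc b) k (suc n) =
  ↔-trans (shift₂-Fiber s w h D zero b k n) (Σ-cong ↔-refl
    (irrelevant-↔ ×-irrelevant ×-irrelevant
      (λ (p , q , r) → p , cong suc q , r) (λ (p , q , r) → p , ℕ.suc-injective q , r)))

VFiber : ℕ → ℤ → ℕ → ℕ → Set
VFiber N = Fiber (vPairs {N}) vSize vCharge

-- Peels the last difference, which is 0, 1 or at least 2.  Raising it by 2 adds two columns of
-- height N + 1, which keeps the charge and adds one to vPairs.
raiseLast : ∀ {N} → Vec ℕ N ⊎ Vec ℕ N ⊎ Vec ℕ (suc N) → Vec ℕ (suc N)
raiseLast (inj₁ xs)        = xs ∷ʳ 0
raiseLast (inj₂ (inj₁ xs)) = xs ∷ʳ 1
raiseLast (inj₂ (inj₂ xs)) = init xs ∷ʳ suc (suc (last xs))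

lowerSnoc : ∀ {N} → Vec ℕ N → ℕ → Vec ℕ N ⊎ Vec ℕ N ⊎ Vec ℕ (suc N)
lowerSnoc xs zero          = inj₁ xs
lowerSnoc xs (suc zero)    = inj₂ (inj₁ xs)
lowerSnoc xs (suc (suc y)) = inj₂ (inj₂ (xs ∷ʳ y))

init-∷ʳ-last : ∀ {N} (xs : Vec ℕ (suc N)) → init xs ∷ʳ last xs ≡ xs
init-∷ʳ-last xs = ≡.sym (proj₂ (proj₂ (initLast xs)))

raiseLast-↔ : ∀ {N} → (Vec ℕ N ⊎ Vec ℕ N ⊎ Vec ℕ (suc N)) ↔ Vec ℕ (suc N)
raiseLast-↔ = mk↔ₛ′ raiseLast lowerLast
  (λ xs → ≡.trans (raise-lower (init xs) (last xs)) (init-∷ʳ-last xs))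
  λ { (inj₁ xs)        → lowerLast-∷ʳ xs 0
    ; (inj₂ (inj₁ xs)) → lowerLast-∷ʳ xs 1
    ; (inj₂ (inj₂ xs)) → ≡.trans (lowerLast-∷ʳ (init xs) _) (cong (inj₂ ∘ inj₂) (init-∷ʳ-last xs))
    }
  where
  lowerLast : ∀ {N} → Vec ℕ (suc N) → Vec ℕ N ⊎ Vec ℕ N ⊎ Vec ℕ (suc N)
  lowerLast xs = lowerSnoc (init xs) (last xs)
  lowerLast-∷ʳ : ∀ {N} (xs : Vec ℕ N) y → lowerLast (xs ∷ʳ y) ≡ lowerSnoc xs y
  lowerLast-∷ʳ xs y = cong₂ lowerSnoc (Vec.init-∷ʳ y xs) (Vec.last-∷ʳ y xs)
  raise-lower : ∀ {N} (xs : Vec ℕ N) y → raiseLast (lowerSnoc xs y) ≡ xs ∷ʳ y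
  raise-lower xs zero          = ≡.refl
  raise-lower xs (suc zero)    = ≡.refl
  raise-lower xs (suc (suc y)) =
    cong₂ (λ zs z → zs ∷ʳ suc (suc z)) (Vec.init-∷ʳ y xs) (Vec.last-∷ʳ y xs)

-- The summands are the last differences 0, 1 and at least 2. The third again has N + 1 rows and is
-- the source of the factor 1 - t q^(2(N+1)).
VFiber-suc : ∀ N D k n →
  (VFiber N D k n ⊎
   shift₂ ⊥ 0 (suc N) (VFiber N (parity (suc N) ℤ.- D)) k n ⊎
   shift₂ ⊥ 1 (2 ℕ.* suc N) (VFiber (suc N) D) k n) ↔ VFiber (suc N) D k n
VFiber-suc N D k n =
  ↔-trans (0-rows ⊎-cong 1-row ⊎-cong 2-rows)
    (↔-trans (↔-refl ⊎-cong ↔-sym Σ-distribʳ-⊎)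
      (↔-trans (↔-sym Σ-distribʳ-⊎)
        (Σ-cong raiseLast-↔ ↔-refl)))
  where
  P : Vec ℕ (suc N) → Set
  P xs = vPairs xs ≡ k × vSize xs ≡ n × vCharge xs ≡ D

  rewriteP : ∀ xs {s w h} → vPairs xs ≡ s → vSize xs ≡ w → vCharge xs ≡ h →
    (s ≡ k × w ≡ n × h ≡ D) ↔ P xs
  rewriteP _ ≡.refl ≡.refl ≡.refl = ↔-refl

  0-rows : VFiber N D k n ↔ Σ (Vec ℕ N) (P ∘ raiseLast ∘ inj₁)
  0-rows = Σ-cong ↔-refl λ {xs} →
    rewriteP (xs ∷ʳ 0) (vPairs-∷ʳ xs 0) (vSize-∷ʳ xs 0) (vCharge-∷ʳ-0 xs)

  reflect : ∀ p x y → x ≡ p ℤ.- y → p ℤ.- x ≡ y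
  reflect p _ y ≡.refl = lemma p y
    where
    lemma : ∀ p y → p ℤ.- (p ℤ.- y) ≡ y
    lemma = ℤ-Solver.solve-∀

  1-row : shift₂ ⊥ 0 (suc N) (VFiber N (parity (suc N) ℤ.- D)) k n ↔
          Σ (Vec ℕ N) (P ∘ raiseLast ∘ inj₂ ∘ inj₁)
  1-row = ↔-trans (shift₂-Fiber vPairs vSize vCharge _ 0 (suc N) k n) (Σ-cong ↔-refl λ {xs} →
    ↔-trans
      (irrelevant-↔ ×-irrelevant ×-irrelevant
        (λ (p , q , r) → p , q , reflect (parity (suc N)) _ D r)
        (λ (p , q , r) → p , q , ≡.sym (reflect (parity (suc N)) _ _ (≡.sym r))))
      (rewriteP (xs ∷ʳ 1) (vPairs-∷ʳ xs 1)
        (≡.trans (vSize-∷ʳ xs 1) (cong (ℕ._+ vSize xs) (ℕ.*-identityˡ (suc N))))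
        (vCharge-∷ʳ-1 xs)))

  2-rows : shift₂ ⊥ 1 (2 ℕ.* suc N) (VFiber (suc N) D) k n ↔
           Σ (Vec ℕ (suc N)) (P ∘ raiseLast ∘ inj₂ ∘ inj₂)
  2-rows = ↔-trans (shift₂-Fiber vPairs vSize vCharge _ 1 (2 ℕ.* suc N) k n) (Σ-cong ↔-refl λ {xs} →
    let ys = init xs ; y = last xs ; xs≡ = init-∷ʳ-last xs in
    rewriteP (ys ∷ʳ suc (suc y))
      (≡.trans (vPairs-∷ʳ ys (suc (suc y)))
        (cong suc (≡.trans (≡.sym (vPairs-∷ʳ ys y)) (cong vPairs xs≡))))
      (≡.trans (vSize-∷ʳ ys (suc (suc y)))
        (≡.trans (lemma N y (vSize ys))
          (cong (2 ℕ.* suc N ℕ.+_) (≡.trans (≡.sym (vSize-∷ʳ ys y)) (cong vSize xs≡)))))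
      (≡.trans (vCharge-∷ʳ-2+ ys y) (cong vCharge xs≡)))
    where
    lemma : ∀ N y t → suc (suc y) ℕ.* suc N ℕ.+ t ≡ 2 ℕ.* suc N ℕ.+ (y ℕ.* suc N ℕ.+ t)
    lemma = ℕ-Solver.solve-∀

-- Finiteness, counting and the generating functions.

Finite : Set → Set
Finite A = ∃ λ c → Fin c ↔ A

finite-↔ : ∀ {A B} → A ↔ B → Finite A → Finite B
finite-↔ A↔B (c , e) = c , ↔-trans e A↔B

finite-⊎ : ∀ {A B} → Finite A → Finite B → Finite (A ⊎ B)
finite-⊎ (c , e) (c′ , e′) = c ℕ.+ c′ , ↔-trans +↔⊎ (e ⊎-cong e′)

Fin0↔ : ∀ {A : Set} → ¬ A → Fin 0 ↔ A
Fin0↔ ¬A = irrelevant-↔ (λ ()) (λ a → contradiction a ¬A) (λ ()) (λ a → contradiction a ¬A)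

Fin1↔ : ∀ {A : Set} → Irrelevant A → A → Fin 1 ↔ A
Fin1↔ irr a = irrelevant-↔ (λ { zero zero → ≡.refl }) irr (λ _ → a) (λ _ → zero)

finite-dec : ∀ {A} → Irrelevant A → Dec A → Finite A
finite-dec irr (yes a) = 1 , Fin1↔ irr a
finite-dec irr (no ¬a) = 0 , Fin0↔ ¬a

VFiber-0-irrelevant : ∀ {D k n} → Irrelevant (VFiber 0 D k n)
VFiber-0-irrelevant ([] , p) ([] , q) = cong ([] ,_) (×-irrelevant p q)

-- Recursion on N and, for fixed N, on the size: the third summand keeps the number of rows but
-- lowers the size by 2(N+1) > 0.
VFiber-finite : ∀ N D k n → Finite (VFiber N D k n)
VFiber-finite zero    D k n = finite-dec VFiber-0-irrelevant dec
  where
  dec : Dec (VFiber 0 D k n)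
  dec with 0 ℕ.≟ k ×-dec 0 ℕ.≟ n ×-dec + 0 ℤ.≟ D
  ... | yes p = yes ([] , p)
  ... | no ¬p = no λ { ([] , p) → ¬p p }
VFiber-finite (suc N) D k n = below (suc n) k n ℕ.≤-refl
  where
  below : ∀ l k n → n < l → Finite (VFiber (suc N) D k n)
  below (suc l) k n (s≤s n≤l) = finite-↔ (VFiber-suc N D k n)
    (finite-⊎ (VFiber-finite N D k n) (finite-⊎
      -- Finiteness is a predicate, so the left side of the relation is filled by a constant family
      -- of zeros.
      (shift₂-rel (λ (_ : ℕ) → Finite) {0A = 0} (0 , Fin0↔ λ ()) 0 (suc N) {F = λ _ _ → 0} k n
        λ k′ n′ _ → VFiber-finite N _ k′ n′)
      (shift₂-rel (λ (_ : ℕ) → Finite) {0A = 0} (0 , Fin0↔ λ ()) 1 (2 ℕ.* suc N) {F = λ _ _ → 0} k n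
        λ { k′ n′ ≡.refl → below l k′ n′ (ℕ.<-≤-trans (ℕ.m<m+n n′ (s≤s z≤n)) n≤l) })))

count : ℕ → ℤ → ℕ → ℕ → ℕ
count N D k n = proj₁ (VFiber-finite N D k n)

-- Any enumeration determines the cardinality, so values of `count` are obtained from bijections and
-- never by computing it.
count-unique : ∀ {N D k n c} → Fin c ↔ VFiber N D k n → c ≡ count N D k n
count-unique {N} {D} {k} {n} e = ↔⇒≡ (↔-trans e (↔-sym (proj₂ (VFiber-finite N D k n))))

count-suc : ∀ N D k n → count (suc N) D k n ≡
  count N D k n ℕ.+ (shift₂ 0 0 (suc N) (count N (parity (suc N) ℤ.- D)) k n ℕ.+
                     shift₂ 0 1 (2 ℕ.* suc N) (count (suc N) D) k n)
count-suc N D k n = ≡.sym (count-unique {suc N} {D} {k} {n} (↔-trans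
  (↔-trans +↔⊎ (counted N D k n ⊎-cong ↔-trans +↔⊎
    (shift₂-rel (λ c A → Fin c ↔ A) (Fin0↔ λ ()) 0 (suc N) k n (λ k′ n′ _ → counted N (parity (suc N) ℤ.- D) k′ n′) ⊎-cong
     shift₂-rel (λ c A → Fin c ↔ A) (Fin0↔ λ ()) 1 (2 ℕ.* suc N) k n
       λ k′ n′ _ → counted (suc N) D k′ n′)))
  (VFiber-suc N D k n)))
  where
  counted : ∀ N D k n → Fin (count N D k n) ↔ VFiber N D k n
  counted N D k n = proj₂ (VFiber-finite N D k n)

series : ℕ → ℤ → Series
series N D k n = + count N D k n

series-zero : series 0 (+ 0) ≈ 1#
series-zero zero    zero    = cong +_ (≡.sym (count-unique {0} {+ 0} {0} {0}
  (Fin1↔ VFiber-0-irrelevant ([] , ≡.refl , ≡.refl , ≡.refl))))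
series-zero zero    (suc n) = cong +_ (≡.sym (count-unique {0} {+ 0} {0} {suc n}
  (Fin0↔ λ { ([] , _ , () , _) })))
series-zero (suc k) n       = cong +_ (≡.sym (count-unique {0} {+ 0} {suc k} {n}
  (Fin0↔ λ { ([] , () , _) })))

series-vanishes : ∀ N → series N (staircaseCharge (suc N)) ≈ 0#
series-vanishes N k n = cong +_ (≡.sym (count-unique {N} {k = k} {n} (Fin0↔ λ (xs , _ , _ , eq) → vCharge≢staircaseCharge xs eq)))

series-suc : ∀ N D → tq-factor (suc N) * series (suc N) D ≈
  series N D + mono 0 (suc N) * series N (parity (suc N) ℤ.- D)
series-suc N D k n =
  ≡.trans (one-mono-* 1 (2 ℕ.* suc N) (series (suc N) D) k n)
    (≡.trans (cong (ℤ._- S₂) recurrence) (≡.trans (lemma (series N D k n) S₁ S₂)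
      (cong (ℤ._+_ (series N D k n)) (≡.sym (mono-* 0 (suc N) (series N D′) k n)))))
  where
  D′ = parity (suc N) ℤ.- D
  S₁ = shift₂ (+ 0) 0 (suc N) (series N D′) k n
  S₂ = shift₂ (+ 0) 1 (2 ℕ.* suc N) (series (suc N) D) k n
  shift-series : ∀ a b N D → + shift₂ 0 a b (count N D) k n ≡ shift₂ (+ 0) a b (series N D) k n
  shift-series a b N D =
    shift₂-rel (λ c z → + c ≡ z) ≡.refl a b {count N D} {series N D} k n λ _ _ _ → ≡.refl
  recurrence : series (suc N) D k n ≡ series N D k n ℤ.+ (S₁ ℤ.+ S₂)
  recurrence = ≡.trans (cong +_ (count-suc N D k n)) (cong (ℤ._+_ (series N D k n))
    (cong₂ ℤ._+_ (shift-series 0 (suc N) N D′) (shift-series 1 (2 ℕ.* suc N) (suc N) D)))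
  lemma : ∀ x y z → (x ℤ.+ (y ℤ.+ z)) ℤ.- z ≡ x ℤ.+ y
  lemma = ℤ-Solver.solve-∀

-- Counts only the partitions with at most N rows whose successive differences are 0 or 1.
reduced : ℕ → ℤ → Series
reduced N D = tq-product N * series N D

reduced-suc : ∀ N D → reduced (suc N) D ≈
  reduced N D + mono 0 (suc N) * reduced N (parity (suc N) ℤ.- D)
reduced-suc N D =
  trans (*-assoc (tq-product N) (tq-factor (suc N)) (series (suc N) D))
    (trans (*-congˡ {tq-product N} (series-suc N D))
      (trans (distribˡ (tq-product N) (series N D) _)
        (+-congˡ {tq-product N * series N D}
          (*-Semigroup.x∙yz≈y∙xz (tq-product N) (mono 0 (suc N)) (series N _)))))

reduced-finite-form : ∀ N a b → a ℕ.+ b ≡ N →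
  reduced N (charge a b) * (q-product a * q-product b) ≈ mono 0 (coreSize a b) * q-product N
reduced-finite-form = finite-form reduced
  (trans (*-identityˡ (series 0 (+ 0))) series-zero)
  reduced-suc
  (λ N → trans (*-congˡ {tq-product N} (series-vanishes N)) (zeroʳ (tq-product N)))

-- Domino removal, the charge and the 2-core.

isPartition-uncons : ∀ {x xs} → IsPartition (x ∷ xs) → headOr0 xs ≤ x × 0 < x × IsPartition xs
isPartition-uncons ([-]     , p ∷ ps) = z≤n , p , [] , ps
isPartition-uncons (q ∷ qs  , p ∷ ps) = q , p , qs , ps

isPartition-∷ : ∀ {x xs} → headOr0 xs ≤ x → 0 < x → IsPartition xs → IsPartition (x ∷ xs)
isPartition-∷ {xs = []}     q p (qs , ps) = [-] , p ∷ ps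
isPartition-∷ {xs = y ∷ ys} q p (qs , ps) = q ∷ qs , p ∷ ps

IsPartition-irrelevant : ∀ {μ} → Irrelevant (IsPartition μ)
IsPartition-irrelevant (p , q) (p′ , q′) =
  cong₂ _,_ (Linked.irrelevant ℕ.≤-irrelevant p p′) (All.irrelevant ℕ.<-irrelevant q q′)

headOr0≤0⇒[] : ∀ {μ} → IsPartition μ → headOr0 μ ≤ 0 → μ ≡ []
headOr0≤0⇒[] {[]}    p       q = ≡.refl
headOr0≤0⇒[] {x ∷ _} (_ , p ∷ _) q = contradiction p (ℕ.≤⇒≯ q)

length≤size : ∀ {μ} → IsPartition μ → length μ ≤ size μ
length≤size {[]}    p = z≤n
length≤size {x ∷ μ} p with isPartition-uncons p
... | _ , 0<x , p′ = ℕ.+-mono-≤ 0<x (length≤size p′)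

-- Signed number of odd rows: black minus white cells in the chessboard colouring.
rowCharge : List ℕ → ℤ
rowCharge []       = + 0
rowCharge (x ∷ xs) = parity x ℤ.- rowCharge xs

pairs : List ℕ → ℕ
pairs []       = 0
pairs (x ∷ xs) = ⌊ x ∸ headOr0 xs /2⌋ ℕ.+ pairs xs

staircase : ℕ → List ℕ
staircase zero    = []
staircase (suc n) = suc n ∷ staircase n

headOr0-staircase : ∀ n → headOr0 (staircase n) ≡ n
headOr0-staircase zero    = ≡.refl
headOr0-staircase (suc n) = ≡.refl

size-staircase : ∀ n → size (staircase n) ≡ triangular n
size-staircase zero    = ≡.refl
size-staircase (suc n) = cong (suc n ℕ.+_) (size-staircase n)

rowCharge-staircase : ∀ n → rowCharge (staircase n) ≡ staircaseCharge n
rowCharge-staircase zero    = ≡.refl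
rowCharge-staircase (suc n) = cong (λ c → parity (suc n) ℤ.- c) (rowCharge-staircase n)

-- `headOr0-≤` lets a removal take place below a longer row, `size-≡` bounds the number of removals,
-- and `charge-≡` is the invariance.
record DominoRemoved (μ ν : List ℕ) : Set where
  constructor removed
  field
    isPartition : IsPartition ν
    headOr0-≤   : headOr0 ν ≤ headOr0 μ
    size-≡      : size μ ≡ 2 ℕ.+ size ν
    charge-≡    : rowCharge ν ≡ rowCharge μ

dropZeros-partition : ∀ {μ} → IsPartition μ → dropZeros μ ≡ μ
dropZeros-partition {[]}        p = ≡.refl
dropZeros-partition {suc x ∷ μ} p = cong (suc x ∷_) (dropZeros-partition (proj₂ (proj₂ (isPartition-uncons p))))
dropZeros-partition {zero ∷ μ}  p with isPartition-uncons p
... | _ , () , _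

-- The parity of the row is unchanged. The row disappears only for x = 2, and then nothing lies
-- below it.
horizontal : ∀ {x xs} → headOr0 xs ℕ.+ 2 ≤ x → IsPartition xs →
  DominoRemoved (x ∷ xs) (dropZeros ((x ∸ 2) ∷ xs))
horizontal {x} {xs} h p with ≡.subst (_≤ x) (ℕ.+-comm (headOr0 xs) 2) h
horizontal {suc (suc zero)} _ p | s≤s (s≤s h) with headOr0≤0⇒[] p h
... | ≡.refl = removed p z≤n ≡.refl ≡.refl
horizontal {suc (suc (suc x))} _ p | s≤s (s≤s h)
  rewrite dropZeros-partition p =
  removed (isPartition-∷ h (s≤s z≤n) p) (ℕ.m≤n+m _ 2) ≡.refl ≡.refl

-- Two equal adjacent rows cancel in the alternating sum, before the removal as well as after it.
vertical : ∀ {y rest} → headOr0 rest < y → IsPartition rest →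
  DominoRemoved (y ∷ y ∷ rest) (dropZeros ((y ∸ 1) ∷ (y ∸ 1) ∷ rest))
vertical {suc zero} (s≤s h) p with headOr0≤0⇒[] p h
... | ≡.refl = removed p z≤n ≡.refl ≡.refl
vertical {suc (suc y)} {rest} (s≤s h) p rewrite dropZeros-partition p =
  removed (isPartition-∷ ℕ.≤-refl (s≤s z≤n) (isPartition-∷ h (s≤s z≤n) p)) (ℕ.n≤1+n _) (lemma y (size rest))
    (cancel (parity (suc y)) (parity y) (rowCharge rest))
  where
  lemma : ∀ y s → suc (suc y) ℕ.+ (suc (suc y) ℕ.+ s) ≡ 2 ℕ.+ (suc y ℕ.+ (suc y ℕ.+ s))
  lemma = ℕ-Solver.solve-∀
  cancel : ∀ p q c → p ℤ.- (p ℤ.- c) ≡ q ℤ.- (q ℤ.- c)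
  cancel = ℤ-Solver.solve-∀

further-down : ∀ {x xs ν} → headOr0 xs ≤ x → 0 < x →
  DominoRemoved xs ν → DominoRemoved (x ∷ xs) (x ∷ ν)
further-down {x} {xs} {ν} h 0<x (removed p h′ s c) =
  removed (isPartition-∷ (ℕ.≤-trans h′ h) 0<x p) ℕ.≤-refl
    (≡.trans (cong (x ℕ.+_) s) (lemma x (size ν))) (cong (λ c → parity x ℤ.- c) c)
  where
  lemma : ∀ x s → x ℕ.+ (2 ℕ.+ s) ≡ 2 ℕ.+ (x ℕ.+ s)
  lemma = ℕ-Solver.solve-∀

Outcome : List ℕ → Maybe (List ℕ) → Set
Outcome μ nothing  = ∃ λ n → μ ≡ staircase n
Outcome μ (just ν) = DominoRemoved μ ν

-- The outcome for the tail is an argument so that the split on `removeDomino (y ∷ rest)` refines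
-- its type together with the goal.
removeDomino-outcome-∷ : ∀ x y rest → IsPartition (x ∷ y ∷ rest) →
  Outcome (y ∷ rest) (removeDomino (y ∷ rest)) → Outcome (x ∷ y ∷ rest) (removeDomino (x ∷ y ∷ rest))
removeDomino-outcome-∷ x y rest p o
  with (y ℕ.+ 2) ≤ᵇ x | ℕ.≤ᵇ-reflects-≤ (y ℕ.+ 2) x | isPartition-uncons p
... | true  | ofʸ y+2≤x | _ , _ , p′ = horizontal y+2≤x p′
... | false | ofⁿ y+2≰x | y≤x , 0<x , p′
  with (x ≡ᵇ y) ∧ (headOr0 rest <ᵇ y)
     | fromEquivalence (ℕ.≡ᵇ⇒≡ x y) (ℕ.≡⇒≡ᵇ x y) ×-reflects ℕ.<ᵇ-reflects-< (headOr0 rest) y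
... | true  | ofʸ (≡.refl , head<y) = vertical head<y (proj₂ (proj₂ (isPartition-uncons p′)))
... | false | ofⁿ ¬vertical
  with removeDomino (y ∷ rest) | o
... | just ν  | r = further-down y≤x 0<x r
-- Without a horizontal domino x ≤ y + 1, and x = y would allow a vertical one because the row below
-- y has length y - 1; hence x = y + 1.
... | nothing | suc n , ≡.refl = suc (suc n) , cong (_∷ staircase (suc n)) (ℕ.≤-antisym
  (ℕ.≤-pred (≡.subst (x <_) (ℕ.+-comm (suc n) 2) (ℕ.≰⇒> y+2≰x)))
  (ℕ.≤∧≢⇒< y≤x λ y≡x → ¬vertical (≡.sym y≡x , ℕ.≤-reflexive (cong suc (headOr0-staircase n)))))

removeDomino-outcome : ∀ μ → IsPartition μ → Outcome μ (removeDomino μ)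
removeDomino-outcome []       p = 0 , ≡.refl
removeDomino-outcome (x ∷ []) p with 2 ≤ᵇ x | ℕ.≤ᵇ-reflects-≤ 2 x | isPartition-uncons p
... | true  | ofʸ 2≤x | _ , _ , p′ = horizontal 2≤x p′
... | false | ofⁿ 2≰x | _ , 0<x , _ = 1 , cong (_∷ []) (ℕ.≤-antisym (ℕ.≤-pred (ℕ.≰⇒> 2≰x)) 0<x)
removeDomino-outcome (x ∷ y ∷ rest) p =
  removeDomino-outcome-∷ x y rest p (removeDomino-outcome (y ∷ rest) (proj₂ (proj₂ (isPartition-uncons p))))

-- A removal keeps the charge and takes two cells for one unit of fuel, so the process ends at a
-- staircase, whose size is determined by its charge.
coreWith-size : ∀ f μ → IsPartition μ → size μ ≤ f →
  + size (coreWith f μ) ≡ binom2j (rowCharge μ)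
coreWith-size zero    []      p _   = ≡.refl
coreWith-size zero    (x ∷ μ) p x≤0 with isPartition-uncons p
... | _ , 0<x , _ = contradiction (ℕ.≤-trans (ℕ.m≤m+n x _) x≤0) (ℕ.<⇒≱ 0<x)
coreWith-size (suc f) μ p μ≤f with removeDomino μ | removeDomino-outcome μ p
... | just ν  | removed p′ _ s c =
  ≡.trans (coreWith-size f ν p′ (ℕ.≤-pred (ℕ.≤-trans (ℕ.n≤1+n _) (≡.subst (_≤ suc f) s μ≤f))))
    (cong binom2j c)
... | nothing | n , ≡.refl =
  ≡.trans (cong +_ (size-staircase n)) (≡.trans (≡.sym (binom2j-staircaseCharge n))
    (cong binom2j (≡.sym (rowCharge-staircase n))))

-- a (2a - 1) - b (2b - 1) = (a - b) (2 (a + b) - 1), whose second factor is odd.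
binom2j-injective : ∀ a b → binom2j a ≡ binom2j b → a ≡ b
binom2j-injective a b eq with ℤ.i*j≡0⇒i≡0∨j≡0 (a ℤ.- b)
  (≡.trans (factorisation a b) (ℤ.i≡j⇒i-j≡0 eq))
  where
  factorisation : ∀ a b → (a ℤ.- b) ℤ.* (+ 2 ℤ.* (a ℤ.+ b) ℤ.- + 1) ≡
    a ℤ.* (+ 2 ℤ.* a ℤ.- + 1) ℤ.- b ℤ.* (+ 2 ℤ.* b ℤ.- + 1)
  factorisation = ℤ-Solver.solve-∀
... | inj₁ a-b≡0 = ℤ.i-j≡0⇒i≡j a b a-b≡0
... | inj₂ odd≡0 = contradiction
  (≡.trans (≡.sym (ℤ.abs-* (+ 2) (a ℤ.+ b))) (cong ∣_∣ (ℤ.i-j≡0⇒i≡j (+ 2 ℤ.* (a ℤ.+ b)) (+ 1) odd≡0)))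
  (ℕ.even≢odd ∣ a ℤ.+ b ∣ 0)

-- `InP` speaks only of the size of the core; the injectivity of `binom2j` recovers the charge.
InP⇒rowCharge : ∀ {j μ} → IsPartition μ → InP j μ → rowCharge μ ≡ j
InP⇒rowCharge {μ = μ} p inP =
  binom2j-injective _ _ (≡.trans (≡.sym (coreWith-size (size μ) μ p ℕ.≤-refl)) inP)

rowCharge⇒InP : ∀ {j μ} → IsPartition μ → rowCharge μ ≡ j → InP j μ
rowCharge⇒InP {μ = μ} p ≡.refl = coreWith-size (size μ) μ p ℕ.≤-refl

-- The statistic h_{2,0} in terms of row differences.

countB-++ : {A : Set} (p : A → Bool) (xs ys : List A) →
  countB p (xs ++ ys) ≡ countB p xs ℕ.+ countB p ys
countB-++ p []       ys = ≡.refl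
countB-++ p (x ∷ xs) ys with p x
... | true  = cong suc (countB-++ p xs ys)
... | false = countB-++ p xs ys

countB-map : {A B : Set} (p : B → Bool) (f : A → B) (xs : List A) →
  countB p (map f xs) ≡ countB (p ∘ f) xs
countB-map p f []       = ≡.refl
countB-map p f (x ∷ xs) with p (f x)
... | true  = cong suc (countB-map p f xs)
... | false = countB-map p f xs

countB-cong : {A : Set} {p q : A → Bool} → (∀ x → p x ≡ q x) → ∀ xs → countB p xs ≡ countB q xs
countB-cong         e []       = ≡.refl
countB-cong {q = q} e (x ∷ xs) rewrite e x with q x
... | true  = cong suc (countB-cong e xs)
... | false = countB-cong e xs

countB-applyUpTo-suc : ∀ (p : ℕ → Bool) n → countB p (applyUpTo suc n) ≡ countB (p ∘ suc) (upTo n)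
countB-applyUpTo-suc p n =
  ≡.trans (cong (countB p) (≡.sym (List.map-applyUpTo (λ i → i) suc n))) (countB-map p suc (upTo n))

-- Rows weakly decrease, so column `c` meets some lower row exactly when it meets the next one.
leg≡0 : ∀ c {xs} → IsPartition xs →
  (countB (λ r → c <ᵇ r) xs ≡ᵇ 0) ≡ not (c <ᵇ headOr0 xs)
leg≡0 c {[]}     p = ≡.refl
leg≡0 c {x ∷ xs} p with c <ᵇ x | ℕ.<ᵇ-reflects-< c x | isPartition-uncons p
... | true  | _       | _ = ≡.refl
... | false | ofⁿ c≮x | h , _ , p′ rewrite leg≡0 c p′
  with c <ᵇ headOr0 xs | ℕ.<ᵇ-reflects-< c (headOr0 xs)
... | true  | ofʸ c<h = contradiction (ℕ.<-≤-trans c<h h) c≮x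
... | false | _       = ≡.refl

-- On the cells from column h on, arm + 1 takes the values 1, ..., r - h, of which half, rounded
-- down, are even.
count-row : ∀ r h →
  countB (λ c → not (c <ᵇ h) ∧ even? (r ∸ suc c ℕ.+ 1)) (upTo r) ≡ ⌊ r ∸ h /2⌋
count-row zero    zero    = ≡.refl
count-row zero    (suc h) = ≡.refl
count-row (suc r) (suc h) = ≡.trans (countB-applyUpTo-suc _ r) (count-row r h)
count-row (suc r) zero    =
  ≡.trans (cong (λ n → if even? (r ℕ.+ 1) then suc n else n)
            (≡.trans (countB-applyUpTo-suc _ r) (count-row r 0)))
    (≡.trans (cong (λ n → if even? n then suc ⌊ r /2⌋ else ⌊ r /2⌋) (ℕ.+-comm r 1)) (lemma r))
  where
  lemma : ∀ r → (if even? (suc r) then suc ⌊ r /2⌋ else ⌊ r /2⌋) ≡ ⌊ suc r /2⌋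
  lemma zero          = ≡.refl
  lemma (suc zero)    = ≡.refl
  lemma (suc (suc r)) with even? (suc r) | lemma r
  ... | true  | eq = cong suc eq
  ... | false | eq = cong suc eq

-- The suffix xs of μ starts at row g 0.
count-cells : ∀ (F : ℕ × ℕ → List (ℕ × ℕ)) → (∀ i r → F (i , r) ≡ map (i ,_) (upTo r)) →
  ∀ μ xs (g : ℕ → ℕ) → (∀ i → lookup0 μ (g i) ≡ lookup0 xs i) →
  (∀ i → drop (suc (g i)) μ ≡ drop (suc i) xs) → IsPartition xs →
  countB (λ v → (leg μ v ≡ᵇ 0) ∧ even? (arm μ v ℕ.+ 1))
         (concatMap F (zip (applyUpTo g (length xs)) xs)) ≡ pairs xs
count-cells F F≡ μ []       g lookup≡ drop≡ p = ≡.refl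
count-cells F F≡ μ (x ∷ xs) g lookup≡ drop≡ p =
  ≡.trans (countB-++ _ (F (g 0 , x)) _) (cong₂ ℕ._+_ row
    (count-cells F F≡ μ xs (g ∘ suc) (lookup≡ ∘ suc) (drop≡ ∘ suc) (proj₂ (proj₂ (isPartition-uncons p)))))
  where
  row : countB (λ v → (leg μ v ≡ᵇ 0) ∧ even? (arm μ v ℕ.+ 1)) (F (g 0 , x)) ≡
        ⌊ x ∸ headOr0 xs /2⌋
  row rewrite F≡ (g 0) x =
    ≡.trans (countB-map _ (g 0 ,_) (upTo x))
      (≡.trans (countB-cong (λ c → cong₂ _∧_
          (≡.trans (cong (λ zs → countB (λ r → c <ᵇ r) zs ≡ᵇ 0) (drop≡ 0))
                   (leg≡0 c (proj₂ (proj₂ (isPartition-uncons p)))))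
          (cong (λ r → even? (r ∸ suc c ℕ.+ 1)) (lookup≡ 0))) (upTo x))
        (count-row x (headOr0 xs)))

h20≡pairs : ∀ μ → IsPartition μ → h20 μ ≡ pairs μ
-- `F` is unified with the pattern-matching lambda inside `cells`; a second copy of that lambda
-- would not be definitionally equal to it.
h20≡pairs μ p = count-cells _ (λ _ _ → ≡.refl) μ μ (λ i → i) (λ _ → ≡.refl) (λ _ → ≡.refl) p

-- The bijection between partitions and difference vectors.

rows : ∀ {N} → Vec ℕ N → List ℕ
rows []       = []
rows (x ∷ xs) with x ℕ.+ Vec.sum xs
... | zero  = []
... | suc r = suc r ∷ rows xs

-- Padded with zeros to length N; inverse to `rows` on partitions with at most N rows.
differences : ∀ N → List ℕ → Vec ℕ N
differences zero    μ       = []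
differences (suc N) []      = 0 ∷ differences N []
differences (suc N) (x ∷ μ) = (x ∸ headOr0 μ) ∷ differences N μ

headOr0-rows : ∀ {N} (xs : Vec ℕ N) → headOr0 (rows xs) ≡ Vec.sum xs
headOr0-rows []       = ≡.refl
headOr0-rows (x ∷ xs) with x ℕ.+ Vec.sum xs
... | zero  = ≡.refl
... | suc r = ≡.refl

rows-isPartition : ∀ {N} (xs : Vec ℕ N) → IsPartition (rows xs)
rows-isPartition []       = [] , []
rows-isPartition (x ∷ xs) with x ℕ.+ Vec.sum xs in eq
... | zero  = [] , []
... | suc r = isPartition-∷ (≡.subst (_≤ suc r) (≡.sym (headOr0-rows xs)) (≡.subst (Vec.sum xs ≤_) eq (ℕ.m≤n+m _ x)))
                (s≤s z≤n) (rows-isPartition xs)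

rows≡[] : ∀ {N} (xs : Vec ℕ N) → Vec.sum xs ≡ 0 → rows xs ≡ []
rows≡[] xs eq = headOr0≤0⇒[] (rows-isPartition xs) (ℕ.≤-reflexive (≡.trans (headOr0-rows xs) eq))

differences-rows : ∀ {N} (xs : Vec ℕ N) → differences N (rows xs) ≡ xs
differences-rows []       = ≡.refl
differences-rows (x ∷ xs) with x ℕ.+ Vec.sum xs in eq
... | zero  = cong₂ _∷_ (≡.sym (ℕ.m+n≡0⇒m≡0 x eq))
                (≡.trans (cong (differences _) (≡.sym (rows≡[] xs (ℕ.m+n≡0⇒n≡0 x eq)))) (differences-rows xs))
... | suc r = cong₂ _∷_
  (≡.trans (cong₂ _∸_ (≡.sym eq) (headOr0-rows xs)) (ℕ.m+n∸n≡m x (Vec.sum xs))) (differences-rows xs)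

sum-differences : ∀ N μ → IsPartition μ → length μ ≤ N → Vec.sum (differences N μ) ≡ headOr0 μ
sum-differences zero    []      p l       = ≡.refl
sum-differences (suc N) []      p l       = sum-differences N [] p z≤n
sum-differences (suc N) (x ∷ μ) p (s≤s l) with isPartition-uncons p
... | h , _ , p′ = ≡.trans (cong (x ∸ headOr0 μ ℕ.+_) (sum-differences N μ p′ l)) (ℕ.m∸n+n≡m h)

rows-differences : ∀ N μ → IsPartition μ → length μ ≤ N → rows (differences N μ) ≡ μ
rows-differences N       []      p l = rows≡[] (differences N []) (sum-differences N [] p z≤n)
rows-differences (suc N) (suc x ∷ μ) p (s≤s l)
  rewrite sum-differences (suc N) (suc x ∷ μ) p (s≤s l) =
  cong (suc x ∷_) (rows-differences N μ (proj₂ (proj₂ (isPartition-uncons p))) l)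
rows-differences (suc N) (zero ∷ μ)  p l with isPartition-uncons p
... | _ , () , _

vSize≡size : ∀ {N} (xs : Vec ℕ N) → vSize xs ≡ size (rows xs)
vSize≡size []       = ≡.refl
vSize≡size (x ∷ xs) with x ℕ.+ Vec.sum xs in eq
... | zero  = ≡.trans (vSize≡size xs) (cong size (rows≡[] xs (ℕ.m+n≡0⇒n≡0 x eq)))
... | suc r = cong (suc r ℕ.+_) (vSize≡size xs)

vCharge≡rowCharge : ∀ {N} (xs : Vec ℕ N) → vCharge xs ≡ rowCharge (rows xs)
vCharge≡rowCharge []       = ≡.refl
vCharge≡rowCharge (x ∷ xs) with x ℕ.+ Vec.sum xs in eq
... | zero  = cong (λ c → + 0 ℤ.- c)
  (≡.trans (vCharge≡rowCharge xs) (cong rowCharge (rows≡[] xs (ℕ.m+n≡0⇒n≡0 x eq))))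
... | suc r = cong (λ c → parity (suc r) ℤ.- c) (vCharge≡rowCharge xs)

vPairs≡pairs : ∀ {N} (xs : Vec ℕ N) → vPairs xs ≡ pairs (rows xs)
vPairs≡pairs []       = ≡.refl
vPairs≡pairs (x ∷ xs) with x ℕ.+ Vec.sum xs in eq
... | zero  = cong₂ (λ y n → ⌊ y /2⌋ ℕ.+ n) (ℕ.m+n≡0⇒m≡0 x eq)
  (≡.trans (vPairs≡pairs xs) (cong pairs (rows≡[] xs (ℕ.m+n≡0⇒n≡0 x eq))))
... | suc r = cong₂ (λ y n → ⌊ y /2⌋ ℕ.+ n)
  (≡.sym (≡.trans (cong₂ _∸_ (≡.sym eq) (headOr0-rows xs)) (ℕ.m+n∸n≡m x (Vec.sum xs)))) (vPairs≡pairs xs)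

-- A partition of n has at most n ≤ N rows, so the bound on the rows loses nothing. All other
-- components are propositions, and only the underlying data has to be compared.
PSet-↔ : ∀ {N n} j k → n ≤ N → PSet j k n ↔ VFiber N j k n
PSet-↔ {N} {n} j k n≤N = mk↔ₛ′ to from
  (λ (xs , _) → Σ-≡,≡→≡ (differences-rows xs , ×-irrelevant _ _))
  (λ (μ , p , _ , sz , _) → Σ-≡,≡→≡ (rows-differences N μ p (bound p sz) , irr _ _))
  where
  bound : ∀ {μ} → IsPartition μ → size μ ≡ n → length μ ≤ N
  bound p ≡.refl = ℕ.≤-trans (length≤size p) n≤N
  irr : ∀ {μ} → Irrelevant (IsPartition μ × InP j μ × size μ ≡ n × h20 μ ≡ k)
  irr (p , e) (p′ , e′) = cong₂ _,_ (IsPartition-irrelevant p p′) (×-irrelevant e e′)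
  to : PSet j k n → VFiber N j k n
  to (μ , p , inP , sz , h) = xs ,
    ≡.trans (vPairs≡pairs xs) (≡.trans (cong pairs rows≡) (≡.trans (≡.sym (h20≡pairs μ p)) h)) ,
    ≡.trans (vSize≡size xs) (≡.trans (cong size rows≡) sz) ,
    ≡.trans (vCharge≡rowCharge xs) (≡.trans (cong rowCharge rows≡) (InP⇒rowCharge p inP))
    where
    xs = differences N μ
    rows≡ = rows-differences N μ p (bound p sz)
  from : VFiber N j k n → PSet j k n
  from (xs , s , w , c) = rows xs , p ,
    rowCharge⇒InP p (≡.trans (≡.sym (vCharge≡rowCharge xs)) c) ,
    ≡.trans (≡.sym (vSize≡size xs)) w ,
    ≡.trans (h20≡pairs (rows xs) p) (≡.trans (≡.sym (vPairs≡pairs xs)) s)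
    where
    p = rows-isPartition xs

-- The limit of the finite form and the identity for infinite products.

≈⇒≈[] : ∀ {n F G} → F ≈ G → F ≈[ n ] G
≈⇒≈[] p k m _ = p k m

≈[]-trans : ∀ {n F G H} → F ≈[ n ] G → G ≈[ n ] H → F ≈[ n ] H
≈[]-trans p q k m m≤n = ≡.trans (p k m m≤n) (q k m m≤n)

≈[]-sym : ∀ {n F G} → F ≈[ n ] G → G ≈[ n ] F
≈[]-sym p k m m≤n = ≡.sym (p k m m≤n)

≈[]-refl : ∀ {n F} → F ≈[ n ] F
≈[]-refl k m m≤n = ≡.refl

-- The finite form at a = n, b = l reads F (q n) (q l) = M (q N). Modulo q^(n+1) both `q l` and
-- `q N` agree with `q n`, so F (q N) (q n) agrees with M (q n), and `q n` cancels.
reduced-limit : ∀ n i → let l = n ℕ.+ i ; N = l ℕ.+ n in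
  reduced N (staircaseCharge i) * q-product N ≈[ n ] mono 0 (triangular i)
reduced-limit n i = q-product-cancel n n
  (≈[]-trans (*-cong[] n {F * q N} {F * q l} {q n} {q n}
               (*-cong[] n {F} {F} {q N} {q l} ≈[]-refl
                 (≈[]-trans (q-product-stable n l) (≈[]-sym l-stable))) ≈[]-refl)
    (≈[]-trans (≈⇒≈[] exact)
      (*-cong[] n {M} {M} {q N} {q n} ≈[]-refl (q-product-stable n l))))
  where
  q = q-product
  l = n ℕ.+ i
  N = l ℕ.+ n
  F = reduced N (staircaseCharge i)
  M = mono 0 (triangular i)
  l-stable : q l ≈[ n ] q n
  l-stable = ≡.subst (λ x → q x ≈[ n ] q n) (ℕ.+-comm i n) (q-product-stable n i)
  exact : (F * q l) * q n ≈ M * q N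
  exact = trans (*-assoc F (q l) (q n)) (trans (*-congˡ {F} (*-comm (q l) (q n)))
    (≡.subst₂ (λ c s → reduced N c * (q n * q l) ≈ mono 0 s * q N)
      (charge-diagonal n i) (coreSize-diagonal n i)
      (reduced-finite-form N n l (ℕ.+-comm n l))))

theorem5p15 : (j : ℤ) (a : ℕ → ℕ → ℕ) →
    (∀ k n → Fin (a k n) ↔ PSet j k n) →
    ∀ k n → ((λ k' n' → + (a k' n')) · prodInf) k n ≡ mono 0 ∣ binom2j j ∣ k n
theorem5p15 j a bij k n with staircaseCharge-surjective j
... | i , ≡.refl =
  ≡.trans (·-* A prodInf k n) (≡.trans
    (*-cong[] n {A} {S} {prodInf} {prodUpTo N} a≈count (prodInf≈[] n (n ℕ.+ i)) k n ℕ.≤-refl)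
    (≡.trans (regroup k n) (≡.trans (reduced-limit n i k n ℕ.≤-refl)
      (cong (λ s → mono 0 ∣ s ∣ k n) (≡.sym (binom2j-staircaseCharge i))))))
  where
  -- The sum of the indices n + i and n, whose charge is `j`. As N ≥ n, every partition of size at
  -- most n fits into N rows, which suffices for the coefficient of q^n.
  N = (n ℕ.+ i) ℕ.+ n
  A S : Series
  A k′ n′ = + a k′ n′
  S = series N (staircaseCharge i)
  a≈count : A ≈[ n ] S
  a≈count k′ m m≤n = cong +_ (count-unique {N}
    (↔-trans (bij k′ m) (PSet-↔ j k′ (ℕ.≤-trans m≤n (ℕ.m≤n+m n _)))))
  regroup : S * prodUpTo N ≈ reduced N (staircaseCharge i) * q-product N
  regroup = trans (*-congˡ {S} (prodUpTo-split N))
    (trans (sym (*-assoc S (tq-product N) (q-product N)))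
      (*-congʳ {q-product N} (*-comm S (tq-product N))))
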